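{- For every matroid $M$, the foundation $F_M$ of $M$ is generated by the universal cross-ratios of $M$.
   Context: **Pastures.** A pointed group is a multiplicatively written commutative monoid $P$ with neutral element $1$ and absorbing element $0\ne1$ in which every nonzero element is invertible; $P^\times=P\setminus\{0\}$. In $\mathrm{Sym}^3(P)=P^3/S_3$ write $a+b+c$ for the class of $(a,b,c)$, $a+b$ for $a+b+0$ and $a$ for $a+0+0$. A pasture is a pointed group $P$ with a subset $N_P\subseteq\mathrm{Sym}^3(P)$ (the null set) that is invariant under multiplication by elements of $P$ and such that for every $a\in P$ there is a unique $b\in P$, denoted $-a$, with $a+b\in N_P$. A pasture morphism $g:P\to Q$ is a multiplicative map preserving $0$ and $1$ with $g(a)+g(b)+g(c)\in N_Q$ whenever $a+b+c\in N_P$. A subset $S\subseteq P^\times$ generates $P$ if $S\cup\{ -1\}$ generates $P^\times$ as a group. **Representations and foundation.** Let $M$ be a matroid on a finite set $E$ with set of hyperplanes $\mathcal H$. A $P$-representation of $M$ is a family $\varphi=(\varphi_H:E\to P)_{H\in\mathcal H}$ with $\varphi_H(e)=0$ iff $e\in H$, such that for all distinct hyperplanes $H_1,H_2,H_3$ whose intersection is a corank $2$ flat there is $(a,b,c)\in P^3\setminus\{(0,0,0)\}$ with $a\varphi_{H_1}(e)+b\varphi_{H_2}(e)+c\varphi_{H_3}(e)\in N_P$ for all $e\in E$. Two representations $\varphi,\varphi'$ are rescaling equivalent if $\varphi'_H(e)=a_Ht_e\varphi_H(e)$ for some $(a_H)\in(P^\times)^{\mathcal H}$, $(t_e)\in(P^\times)^E$.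 $\mathrm R_M(P)$ is the set of rescaling classes of $P$-representations of $M$, a functor in $P$ by composing hyperplane functions with morphisms. The foundation $F_M$ is the pasture representing this functor: $\mathrm R_M(P)=\mathrm{Hom}(F_M,P)$ functorially in $P$ (it exists and is unique up to unique isomorphism). A universal representation $\varphi_{\mathrm{univ}}$ is an $F_M$-representation of $M$ whose rescaling class corresponds to $\mathrm{id}_{F_M}$. **Universal cross-ratios.** Let $\Theta_M$ be the set of $4$-tuples of hyperplanes $(H_1,H_2,H_3,H_4)$ such that $L=H_1\cap H_2\cap H_3\cap H_4$ is a corank $2$ flat and $L=H_i\cap H_j$ for all $i\in\{1,2\}$, $j\in\{3,4\}$. For $(H_1,H_2,H_3,H_4)\in\Theta_M$, choose $a\in H_3-L$ and $b\in H_4-L$; the universal cross-ratio of this tuple is $$\begin{bmatrix}H_1&H_2\\H_3&H_4\end{bmatrix}=\frac{\varphi_{\mathrm{univ},H_1}(a)\,\varphi_{\mathrm{univ},H_2}(b)}{\varphi_{\mathrm{univ},H_1}(b)\,\varphi_{\mathrm{univ},H_2}(a)}\in F_M^\times,$$ which is independent of the choices of $a$, $b$ and $\varphi_{\mathrm{univ}}$. -}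

module Defs where

open import Algebra.Bundles using (CommutativeMonoid; Group)
open import Algebra.Definitions using (Zero)
open import Algebra.Morphism.Structures using (module MonoidMorphisms)
import Algebra.Properties.CommutativeSemigroup as CommutativeSemigroupProperties
open import Algebra.Structures using (IsCommutativeMonoid)
open import Data.Fin.Base using (Fin)
open import Data.Fin.Subset using (Subset; _∈_; _∉_; _⊆_; _∪_; _∩_; ⁅_⁆; ∣_∣; ⊤)
open import Data.Fin.Subset.Properties using (_∈?_; x∈p∩q⁺)
open import Data.Nat.Base using (ℕ; _+_; _≤_; _<_)
open import Data.Product using (∃!; ∃-syntax; _×_; _,_; proj₁; proj₂)
open import Data.Refinement using (Refinement; value)
open import Data.Sum.Base using (_⊎_)
open import Function.Base using (_∘_; id)
open import Function.Bundles using (_⇔_; mk⇔; Equivalence; Inverse)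
open import Level using (Level; _⊔_) renaming (suc to lsuc)
open import Relation.Binary.Bundles using (Setoid)
open import Relation.Binary.Core using (Rel)
open import Relation.Binary.PropositionalEquality.Core using (_≡_; _≢_; subst; sym)
open import Relation.Nullary.Decidable.Core using (yes; no)
open import Relation.Nullary.Negation.Core using (¬_; contradiction)
open import Relation.Unary using (Pred)
import Relation.Binary.Reasoning.Setoid as SetoidReasoning

private
  variable
    n : ℕ
    ℓ : Level

-- The underlying set is a setoid, since quotients are not available; a ≠ b
-- reads ¬ a ≈ b.
record PointedGroup ℓ : Set (lsuc ℓ) where
  infixl 7 _*_
  infix  4 _≈_ _≉_
  field
    Carrier             : Set ℓ
    _≈_                 : Rel Carrier ℓ
    _*_                 : Carrier → Carrier → Carrier
    0# 1#               : Carrier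
    isCommutativeMonoid : IsCommutativeMonoid _≈_ _*_ 1#
    zero                : Zero _≈_ 0# _*_
    0≉1                 : ¬ 0# ≈ 1#
    inverse             : ∀ a → ¬ a ≈ 0# → ∃[ b ] a * b ≈ 1#

  _≉_ : Rel Carrier ℓ
  a ≉ b = ¬ a ≈ b

  commutativeMonoid : CommutativeMonoid ℓ ℓ
  commutativeMonoid = record { isCommutativeMonoid = isCommutativeMonoid }

  open CommutativeMonoid commutativeMonoid public
    using (rawMonoid; commutativeSemigroup; setoid; refl; reflexive; trans; assoc; comm; identityˡ; identityʳ)
    renaming (sym to ≈-sym; ∙-cong to *-cong; ∙-congˡ to *-congˡ; ∙-congʳ to *-congʳ)

  Unit : Set ℓ
  Unit = ∃[ a ] a ≉ 0#

  invertible⇒≉0 : ∀ {a b} → a * b ≈ 1# → a ≉ 0#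
  invertible⇒≉0 {a} {b} ab≈1 a≈0 =
    0≉1 (trans (≈-sym (proj₁ zero b)) (trans (*-congʳ (≈-sym a≈0)) ab≈1))

  *-≉0 : ∀ {a b} → a ≉ 0# → b ≉ 0# → a * b ≉ 0#
  *-≉0 {a} {b} a≉0 b≉0 ab≈0 with inverse b b≉0
  ... | b⁻¹ , bb⁻¹≈1 = a≉0 (begin
    a              ≈⟨ identityʳ a ⟨
    a * 1#         ≈⟨ *-congˡ bb⁻¹≈1 ⟨
    a * (b * b⁻¹)  ≈⟨ assoc a b b⁻¹ ⟨
    a * b * b⁻¹    ≈⟨ *-congʳ ab≈0 ⟩
    0# * b⁻¹       ≈⟨ proj₁ zero b⁻¹ ⟩
    0#             ∎)
    where open SetoidReasoning setoid

  infix 8 _⁻¹ᵘ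
  _⁻¹ᵘ : Unit → Unit
  (a , a≉0) ⁻¹ᵘ with inverse a a≉0
  ... | b , ab≈1 = b , invertible⇒≉0 (trans (comm b a) ab≈1)

  inverseʳᵘ : ∀ u → proj₁ u * proj₁ (u ⁻¹ᵘ) ≈ 1#
  inverseʳᵘ (a , a≉0) = proj₂ (inverse a a≉0)

  inverseˡᵘ : ∀ u → proj₁ (u ⁻¹ᵘ) * proj₁ u ≈ 1#
  inverseˡᵘ u = trans (comm _ _) (inverseʳᵘ u)

  unitGroup : Group ℓ ℓ
  unitGroup = record
    { Carrier = Unit
    ; _≈_     = λ u v → proj₁ u ≈ proj₁ v
    ; _∙_     = λ (a , a≉0) (b , b≉0) → a * b , *-≉0 a≉0 b≉0
    ; ε       = 1# , λ 1≈0 → 0≉1 (≈-sym 1≈0)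
    ; _⁻¹     = _⁻¹ᵘ
    ; isGroup = record
      { isMonoid = record
        { isSemigroup = record
          { isMagma = record
            { isEquivalence = record { refl = refl ; sym = ≈-sym ; trans = trans }
            ; ∙-cong        = *-cong
            }
          ; assoc = λ u v w → assoc (proj₁ u) (proj₁ v) (proj₁ w)
          }
        ; identity = (λ u → identityˡ (proj₁ u)) , (λ u → identityʳ (proj₁ u))
        }
      ; inverse = inverseˡᵘ , inverseʳᵘ
      ; ⁻¹-cong = λ {u} {v} → ⁻¹-cong u v
      }
    }
    where
    open SetoidReasoning setoid
    ⁻¹-cong : ∀ u v → proj₁ u ≈ proj₁ v → proj₁ (u ⁻¹ᵘ) ≈ proj₁ (v ⁻¹ᵘ)
    ⁻¹-cong u@(a , _) v@(b , _) a≈b = begin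
      u′            ≈⟨ identityʳ u′ ⟨
      u′ * 1#       ≈⟨ *-congˡ (inverseʳᵘ v) ⟨
      u′ * (b * v′) ≈⟨ assoc u′ b v′ ⟨
      u′ * b * v′   ≈⟨ *-congʳ (*-congˡ a≈b) ⟨
      u′ * a * v′   ≈⟨ *-congʳ (inverseˡᵘ u) ⟩
      1# * v′       ≈⟨ identityˡ v′ ⟩
      v′            ∎
      where
      u′ = proj₁ (u ⁻¹ᵘ)
      v′ = proj₁ (v ⁻¹ᵘ)

-- A subset of Sym³(P) is a predicate on triples invariant under S₃, which is
-- generated by the two adjacent transpositions.  Null a b c is "a + b + c ∈ N".
record Pasture ℓ : Set (lsuc ℓ) where
  field
    pointedGroup : PointedGroup ℓ
  open PointedGroup pointedGroup public
  field
    Null       : Carrier → Carrier → Carrier → Set ℓ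
    Null-resp  : ∀ {a a′ b b′ c c′} → a ≈ a′ → b ≈ b′ → c ≈ c′ → Null a b c → Null a′ b′ c′
    Null-swap₁ : ∀ {a b c} → Null a b c → Null b a c
    Null-swap₂ : ∀ {a b c} → Null a b c → Null a c b
    Null-scale : ∀ d {a b c} → Null a b c → Null (d * a) (d * b) (d * c)
    negation   : ∀ a → ∃! _≈_ (λ b → Null a b 0#)

  infix 8 -_
  -_ : Carrier → Carrier
  - a = proj₁ (negation a)

  -1≉0 : - 1# ≉ 0#
  -1≉0 -1≈0 = 0≉1 (trans (≈-sym (-0-unique null-000)) (-0-unique null-010))
    where
    -0-unique : ∀ {b} → Null 0# b 0# → - 0# ≈ b
    -0-unique = proj₂ (proj₂ (negation 0#))
    null-100 : Null 1# 0# 0#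
    null-100 = Null-resp refl -1≈0 refl (proj₁ (proj₂ (negation 1#)))
    null-010 : Null 0# 1# 0#
    null-010 = Null-swap₁ null-100
    null-000 : Null 0# 0# 0#
    null-000 = Null-resp (proj₁ zero 1#) (proj₁ zero 0#) (proj₁ zero 0#) (Null-scale 0# null-100)

  -1ᵘ : Unit
  -1ᵘ = - 1# , -1≉0

record PastureHom {ℓ} (P Q : Pasture ℓ) : Set ℓ where
  private
    module P = Pasture P
    module Q = Pasture Q
  open MonoidMorphisms P.rawMonoid Q.rawMonoid using (IsMonoidHomomorphism)
  field
    ⟦_⟧                  : P.Carrier → Q.Carrier
    isMonoidHomomorphism : IsMonoidHomomorphism ⟦_⟧
    0#-homo              : ⟦ P.0# ⟧ Q.≈ Q.0#
    Null-homo            : ∀ {a b c} → P.Null a b c → Q.Null ⟦ a ⟧ ⟦ b ⟧ ⟦ c ⟧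
  open IsMonoidHomomorphism isMonoidHomomorphism public
    using (⟦⟧-cong) renaming (homo to *-homo; ε-homo to 1#-homo)

  ≉0-homo : ∀ {a} → a P.≉ P.0# → ⟦ a ⟧ Q.≉ Q.0#
  ≉0-homo {a} a≉0 with P.inverse a a≉0
  ... | b , ab≈1 = Q.invertible⇒≉0
    (Q.trans (Q.≈-sym (*-homo a b)) (Q.trans (⟦⟧-cong ab≈1) 1#-homo))

idHom : {P : Pasture ℓ} → PastureHom P P
idHom {P = P} = record
  { ⟦_⟧ = id
  ; isMonoidHomomorphism = record
    { isMagmaHomomorphism = record
      { isRelHomomorphism = record { cong = id }
      ; homo              = λ _ _ → refl
      }
    ; ε-homo = refl
    }
  ; 0#-homo   = refl
  ; Null-homo = id
  }
  where open Pasture P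

infixr 9 _∘ʰ_
_∘ʰ_ : {P Q R : Pasture ℓ} → PastureHom Q R → PastureHom P Q → PastureHom P R
_∘ʰ_ {R = R} g f = record
  { ⟦_⟧ = g.⟦_⟧ ∘ f.⟦_⟧
  ; isMonoidHomomorphism = record
    { isMagmaHomomorphism = record
      { isRelHomomorphism = record { cong = g.⟦⟧-cong ∘ f.⟦⟧-cong }
      ; homo              = λ a b → trans (g.⟦⟧-cong (f.*-homo a b)) (g.*-homo _ _)
      }
    ; ε-homo = trans (g.⟦⟧-cong f.1#-homo) g.1#-homo
    }
  ; 0#-homo   = trans (g.⟦⟧-cong f.0#-homo) g.0#-homo
  ; Null-homo = g.Null-homo ∘ f.Null-homo
  }
  where
  open Pasture R using (trans)
  module f = PastureHom f
  module g = PastureHom g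

homSetoid : Pasture ℓ → Pasture ℓ → Setoid ℓ ℓ
homSetoid P Q = record
  { Carrier       = PastureHom P Q
  ; _≈_           = λ f g → ∀ a → PastureHom.⟦_⟧ f a ≈ PastureHom.⟦_⟧ g a
  ; isEquivalence = record
    { refl  = λ _ → refl
    ; sym   = λ f≈g a → ≈-sym (f≈g a)
    ; trans = λ f≈g g≈h a → trans (f≈g a) (g≈h a)
    }
  }
  where open Pasture Q

module _ {c ℓ} (G : Group c ℓ) where
  open Group G

  data Span {s} (S : Pred Carrier s) : Carrier → Set (c ⊔ ℓ ⊔ s) where
    gen  : ∀ {x} → S x → Span S x
    unit : Span S ε
    mul  : ∀ {x y} → Span S x → Span S y → Span S (x ∙ y)
    inv  : ∀ {x} → Span S x → Span S (x ⁻¹)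
    resp : ∀ {x y} → x ≈ y → Span S x → Span S y

Generates : (P : Pasture ℓ) → Pred (Pasture.Unit P) ℓ → Set ℓ
Generates P S = ∀ u → Span unitGroup (λ v → S v ⊎ v ≈ᵘ -1ᵘ) u
  where
  open Pasture P
  open Group unitGroup using () renaming (_≈_ to _≈ᵘ_)

-- A matroid on the finite set Fin n, axiomatised by its rank function.
record Matroid (n : ℕ) : Set where
  field
    rank       : Subset n → ℕ
    bounded    : ∀ A → rank A ≤ ∣ A ∣
    monotone   : ∀ {A B} → A ⊆ B → rank A ≤ rank B
    submodular : ∀ A B → rank (A ∪ B) + rank (A ∩ B) ≤ rank A + rank B

  IsFlat : Subset n → Set
  IsFlat A = ∀ {e} → e ∉ A → rank A < rank (A ∪ ⁅ e ⁆)

  IsFlatOfCorank : ℕ → Subset n → Set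
  IsFlatOfCorank k A = IsFlat A × k + rank A ≡ rank ⊤

  -- The membership proof is irrelevant, so that hyperplanes are equal as soon
  -- as the underlying subsets are.
  Hyperplane : Set
  Hyperplane = Refinement (Subset n) (IsFlatOfCorank 1)

module _ {n ℓ} (M : Matroid n) (P : Pasture ℓ) where
  open Matroid M
  open Pasture P

  record Representation : Set ℓ where
    field
      φ          : Hyperplane → Fin n → Carrier
      vanishing  : ∀ H e → φ H e ≈ 0# ⇔ e ∈ value H
      three-term : ∀ H₁ H₂ H₃ → H₁ ≢ H₂ → H₁ ≢ H₃ → H₂ ≢ H₃ →
                   IsFlatOfCorank 2 (value H₁ ∩ value H₂ ∩ value H₃) →
                   ∃[ a ] ∃[ b ] ∃[ c ] ¬ (a ≈ 0# × b ≈ 0# × c ≈ 0#) ×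
                   (∀ e → Null (a * φ H₁ e) (b * φ H₂ e) (c * φ H₃ e))

    φᵘ : ∀ H e → e ∉ value H → Unit
    φᵘ H e e∉H = φ H e , e∉H ∘ Equivalence.to (vanishing H e)

  record _∼_ (ρ ρ′ : Representation) : Set ℓ where
    private
      module ρ = Representation ρ
      module ρ′ = Representation ρ′
    field
      α       : Hyperplane → Unit
      t       : Fin n → Unit
      rescale : ∀ H e → ρ′.φ H e ≈ proj₁ (α H) * proj₁ (t e) * ρ.φ H e

  private
    open Group unitGroup using (ε; _∙_)

    compose : ∀ {a b a′ b′ x y z} → y ≈ a * b * x → z ≈ a′ * b′ * y →
              z ≈ (a′ * a) * (b′ * b) * x
    compose {a} {b} {a′} {b′} {x} {y} {z} y≈abx z≈a′b′y = begin
      z                        ≈⟨ z≈a′b′y ⟩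
      a′ * b′ * y              ≈⟨ *-congˡ y≈abx ⟩
      a′ * b′ * (a * b * x)    ≈⟨ assoc _ _ _ ⟨
      a′ * b′ * (a * b) * x    ≈⟨ *-congʳ (interchange a′ b′ a b) ⟩
      (a′ * a) * (b′ * b) * x  ∎
      where
      open SetoidReasoning setoid
      open CommutativeSemigroupProperties commutativeSemigroup using (interchange)

    undo : ∀ u v {x y} → y ≈ proj₁ u * proj₁ v * x → x ≈ proj₁ (u ⁻¹ᵘ) * proj₁ (v ⁻¹ᵘ) * y
    undo u@(a , _) v@(b , _) {x} {y} y≈abx = ≈-sym (begin
      a′ * b′ * y              ≈⟨ compose y≈abx refl ⟩
      (a′ * a) * (b′ * b) * x  ≈⟨ *-congʳ (*-cong (inverseˡᵘ u) (inverseˡᵘ v)) ⟩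
      1# * 1# * x              ≈⟨ *-congʳ (identityˡ 1#) ⟩
      1# * x                   ≈⟨ identityˡ x ⟩
      x                        ∎)
      where
      open SetoidReasoning setoid
      a′ = proj₁ (u ⁻¹ᵘ)
      b′ = proj₁ (v ⁻¹ᵘ)

  -- R_M(P), as a setoid whose equality is rescaling equivalence.
  rescalingClasses : Setoid ℓ ℓ
  rescalingClasses = record
    { Carrier       = Representation
    ; _≈_           = _∼_
    ; isEquivalence = record
      { refl  = record
        { α       = λ _ → ε
        ; t       = λ _ → ε
        ; rescale = λ _ _ → ≈-sym (trans (*-congʳ (identityˡ 1#)) (identityˡ _))
        }
      ; sym   = λ r → record
        { α       = λ H → α r H ⁻¹ᵘ
        ; t       = λ e → t r e ⁻¹ᵘ
        ; rescale = λ H e → undo (α r H) (t r e) (rescale r H e)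
        }
      ; trans = λ r s → record
        { α       = λ H → α s H ∙ α r H
        ; t       = λ e → t s e ∙ t r e
        ; rescale = λ H e → compose (rescale r H e) (rescale s H e)
        }
      }
    }
    where open _∼_

pushforward : {M : Matroid n} {P Q : Pasture ℓ} →
              PastureHom P Q → Representation M P → Representation M Q
pushforward {M = M} {P} {Q} g ρ = record
  { φ          = λ H e → ⟦ φ H e ⟧
  ; vanishing  = λ H e → mk⇔ (zero⇒∈ H e)
                   (λ e∈H → Q.trans (⟦⟧-cong (Equivalence.from (vanishing H e) e∈H)) 0#-homo)
  ; three-term = λ H₁ H₂ H₃ H₁≢H₂ H₁≢H₃ H₂≢H₃ corank2 →
      let a , b , c , nonzero , null = three-term H₁ H₂ H₃ H₁≢H₂ H₁≢H₃ H₂≢H₃ corank2 in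
      ⟦ a ⟧ , ⟦ b ⟧ , ⟦ c ⟧ ,
      (λ (ga≈0 , gb≈0 , gc≈0) →
        ≉0-homo (λ a≈0 → ≉0-homo (λ b≈0 → ≉0-homo (λ c≈0 →
          nonzero (a≈0 , b≈0 , c≈0)) gc≈0) gb≈0) ga≈0) ,
      λ e → Q.Null-resp (*-homo _ _) (*-homo _ _) (*-homo _ _) (Null-homo (null e))
  }
  where
  module P = Pasture P
  module Q = Pasture Q
  open PastureHom g
  open Representation ρ
  zero⇒∈ : ∀ H e → ⟦ φ H e ⟧ Q.≈ Q.0# → e ∈ value H
  zero⇒∈ H e gφ≈0 with e ∈? value H
  ... | yes e∈H = e∈H
  ... | no  e∉H = contradiction gφ≈0 (≉0-homo (e∉H ∘ Equivalence.to (vanishing H e)))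

-- A natural isomorphism Hom(F, -) ≅ R_M of functors on pastures; as usual,
-- all pastures involved live in one fixed universe.
record IsFoundation {n ℓ} (M : Matroid n) (F : Pasture ℓ) : Set (lsuc ℓ) where
  field
    represents : ∀ P → Inverse (homSetoid F P) (rescalingClasses M P)

  classify : ∀ {P} → PastureHom F P → Representation M P
  classify {P} = Inverse.to (represents P)

  field
    natural : ∀ {P Q} (g : PastureHom P Q) (f : PastureHom F P) →
              _∼_ M Q (classify (g ∘ʰ f)) (pushforward g (classify f))

IsUniversal : {M : Matroid n} {F : Pasture ℓ} → IsFoundation M F → Representation M F → Set ℓ
IsUniversal {M = M} {F} isFoundation ρ = _∼_ M F (IsFoundation.classify isFoundation idHom) ρ

module _ {n} (M : Matroid n) where
  open Matroid M

  record Θ : Set where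
    field
      H₁ H₂ H₃ H₄ : Hyperplane
    L : Subset n
    L = value H₁ ∩ value H₂ ∩ value H₃ ∩ value H₄
    field
      corank2 : IsFlatOfCorank 2 L
      L≡H₁∩H₃ : L ≡ value H₁ ∩ value H₃
      L≡H₁∩H₄ : L ≡ value H₁ ∩ value H₄
      L≡H₂∩H₃ : L ≡ value H₂ ∩ value H₃
      L≡H₂∩H₄ : L ≡ value H₂ ∩ value H₄

  record Choice (θ : Θ) : Set where
    open Θ θ
    field
      a b  : Fin n
      a∈H₃ : a ∈ value H₃
      a∉L  : a ∉ L
      b∈H₄ : b ∈ value H₄
      b∉L  : b ∉ L

crossRatio : {M : Matroid n} {P : Pasture ℓ} → Representation M P →
             (θ : Θ M) → Choice M θ → Pasture.Unit P
crossRatio {P = P} ρ θ choice =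
  (φᵘ H₁ a (∉ L≡H₁∩H₃ a∈H₃ a∉L) ∙ φᵘ H₂ b (∉ L≡H₂∩H₄ b∈H₄ b∉L)) //
  (φᵘ H₁ b (∉ L≡H₁∩H₄ b∈H₄ b∉L) ∙ φᵘ H₂ a (∉ L≡H₂∩H₃ a∈H₃ a∉L))
  where
  open Representation ρ
  open Θ θ
  open Choice choice
  open Group (Pasture.unitGroup P) using (_∙_; _//_)
  ∉ : ∀ {A B e} → L ≡ A ∩ B → e ∈ B → e ∉ L → e ∉ A
  ∉ L≡A∩B e∈B e∉L e∈A = e∉L (subst (_ ∈_) (sym L≡A∩B) (x∈p∩q⁺ (e∈A , e∈B)))

-- The cross-ratio of θ does not depend on the points a and b; they are fixed
-- here by an arbitrary choice for each θ.
CrossRatios : {M : Matroid n} {P : Pasture ℓ} → Representation M P →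
              (∀ θ → Choice M θ) → Pred (Pasture.Unit P) ℓ
CrossRatios {P = P} ρ choice u = ∃[ θ ] u ≈ crossRatio ρ θ (choice θ)
  where open Group (Pasture.unitGroup P) using (_≈_)

-- Let C be the subpasture of F on 0 and the subgroup of units spanned by -1 and
-- the cross-ratios.  If the universal representation can be rescaled to take
-- values in C, it is classified by a morphism F → C whose composite with the
-- inclusion C → F classifies the universal representation again; so this
-- composite is the identity, and C = F.
--
-- Rescaling is possible because, modulo C, the ratios q_H(e, f) = φ_H(e) / φ_H(f)
-- depend only on e and f, and satisfy q(e, f) q(f, g) = q(e, g).  By triviality
-- of the cross-ratios q_H(e, f) does not change when H moves to a hyperplane
-- meeting it in corank 2 and also avoiding e and f.  Such moves show, by
-- induction on the number of elements of a circuit outside H, that for e and f on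
-- a circuit the ratio is determined by the circuit; any two elements outside H
-- lie on a circuit meeting the complement of H in these two elements only.
-- Multiplicativity is clear if some hyperplane avoids e, f and g, and follows
-- from the three-term relation if they form a triangle in a contraction; one of
-- these happens because e, f and g are the elements of a connected minor.
module Submission where

open import Defs
open import Algebra.Bundles using (AbelianGroup; Group)
import Algebra.Properties.AbelianGroup as AbelianGroupProperties
import Algebra.Properties.CommutativeSemigroup as CommutativeSemigroupProperties
import Algebra.Properties.Group as GroupProperties
open import Data.Bool.Base using (true)
open import Data.Fin.Base using (Fin)
open import Data.Fin.Properties using (all?; any?) renaming (_≟_ to _≟ᶠ_)
open import Data.Fin.Subset
  using (Subset; inside; outside; _∈_; _∉_; _⊆_; _∪_; _∩_; _-_; ⁅_⁆; ∣_∣; ∁; Nonempty)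
  renaming (⊤ to full; ⊥ to ∅)
open import Data.Fin.Subset.Properties
open import Data.Irrelevant using ([_])
open import Data.Nat.Base using (ℕ; zero; suc; _+_; _≤_; _<_; s≤s; s≤s⁻¹)
open import Data.Nat.Properties
  using ( ≤-refl; ≤-reflexive; ≤-trans; ≤-antisym; <-irrefl; <⇒≱; ≰⇒>; ≤-<-connex; suc-injective; module ≤-Reasoning
        ; m≤m+n; +-comm; +-suc; +-mono-≤; +-mono-<-≤; +-monoˡ-≤; +-monoʳ-≤; +-monoʳ-<
        ; +-cancelˡ-≤; +-cancelʳ-≤; +-cancelˡ-<; +-cancelʳ-<; _≟_; _≤?_; _<?_ )
open import Data.Nat.Tactic.RingSolver using (solve-∀)
open import Data.Product using (Σ-syntax; ∃-syntax; _×_; _,_; proj₁; proj₂)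
open import Data.Refinement using (value; value-injective; _,_)
open import Data.Sum.Base using (_⊎_; inj₁; inj₂; [_,_]′)
open import Data.Vec.Base using (_∷_; []; here; there; tabulate)
open import Data.Vec.Functional using (updateAt)
open import Data.Vec.Functional.Properties using (updateAt-minimal; updateAt-updates)
open import Data.Vec.Properties using (lookup∘tabulate; lookup⇒[]=; []=⇒lookup)
open import Function.Base using (_∘_; const; id)
open import Function.Bundles using (Equivalence; Inverse; mk⇔)
open import Level using (Level; _⊔_)
open import Relation.Binary.PropositionalEquality
  using (_≡_; _≢_; cong; cong₂; subst)
  renaming (refl to ≡-refl; sym to ≡-sym; trans to ≡-trans)
import Relation.Binary.Reasoning.Setoid as SetoidReasoning
open import Relation.Nullary.Decidable
  using (Dec; yes; no; does; dec-true; decidable-stable; map′; recompute; _×-dec_; _→-dec_; ¬?)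
open import Relation.Nullary.Negation using (¬_; contradiction)
open import Relation.Unary using (Decidable; Pred)

private
  variable
    n : ℕ
    ℓ ℓ₁ ℓ₂ : Level

-- Finite subsets: induction and minimal subsets.

module _ {A B : Subset n} where

  ∈-∪ˡ : A ⊆ A ∪ B
  ∈-∪ˡ = p⊆p∪q B

  ∈-∪ʳ : B ⊆ A ∪ B
  ∈-∪ʳ = q⊆p∪q A B

  ∪-least : ∀ {C} → A ⊆ C → B ⊆ C → A ∪ B ⊆ C
  ∪-least A⊆C B⊆C = [ A⊆C , B⊆C ]′ ∘ x∈p∪q⁻ A B

⁅⁆-⊆ : ∀ {e} {A : Subset n} → e ∈ A → ⁅ e ⁆ ⊆ A
⁅⁆-⊆ {e = e} e∈A f∈⁅e⁆ rewrite x∈⁅y⁆⇒x≡y e f∈⁅e⁆ = e∈A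

∈-∪-∉ˡ : ∀ (A B : Subset n) {e} → e ∈ A ∪ B → e ∉ A → e ∈ B
∈-∪-∉ˡ A B e∈ e∉A = [ (λ e∈A → contradiction e∈A e∉A) , id ]′ (x∈p∪q⁻ A B e∈)

∈-∪-∉ʳ : ∀ (A B : Subset n) {e} → e ∈ A ∪ B → e ∉ B → e ∈ A
∈-∪-∉ʳ A B e∈ e∉B = [ id , (λ e∈B → contradiction e∈B e∉B) ]′ (x∈p∪q⁻ A B e∈)

∪-mono : ∀ {A B C D : Subset n} → A ⊆ C → B ⊆ D → A ∪ B ⊆ C ∪ D
∪-mono A⊆C B⊆D = ∪-least (∈-∪ˡ ∘ A⊆C) (∈-∪ʳ ∘ B⊆D)

∈-insert : ∀ {e} {A : Subset n} → e ∈ A ∪ ⁅ e ⁆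
∈-insert {e = e} = ∈-∪ʳ (x∈⁅x⁆ e)

insert-⊆ : ∀ {e} {A C : Subset n} → A ⊆ C → e ∈ C → A ∪ ⁅ e ⁆ ⊆ C
insert-⊆ A⊆C e∈C = ∪-least A⊆C (⁅⁆-⊆ e∈C)

∉-insert : ∀ {e f} {A : Subset n} → e ∉ A → e ≢ f → e ∉ A ∪ ⁅ f ⁆
∉-insert {f = f} {A} e∉A e≢f = [ e∉A , e≢f ∘ x∈⁅y⁆⇒x≡y f ]′ ∘ x∈p∪q⁻ A ⁅ f ⁆

∈-remove⁻ : ∀ {e f} {A : Subset n} → e ∈ A - f → e ∈ A
∈-remove⁻ {f = f} {A} = p─q⊆p A ⁅ f ⁆

∉-remove : ∀ {e} {A : Subset n} → e ∉ A - e
∉-remove {e = Fin.zero}  {_ ∷ _} ()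
∉-remove {e = Fin.suc e} {_ ∷ A} (there e∈A-e) = ∉-remove {A = A} e∈A-e

∈-remove⇒≢ : ∀ (A : Subset n) {e f} → e ∈ A - f → e ≢ f
∈-remove⇒≢ A e∈A-e ≡-refl = ∉-remove {A = A} e∈A-e

∈-∉⇒≢ : ∀ {e f} {A : Subset n} → e ∈ A → f ∉ A → e ≢ f
∈-∉⇒≢ e∈A f∉A ≡-refl = f∉A e∈A

∃-or-⊆ : (A B : Subset n) → (∃[ e ] e ∈ A × e ∉ B) ⊎ A ⊆ B
∃-or-⊆ A B with any? (λ e → (e ∈? A) ×-dec ¬? (e ∈? B))
... | yes found = inj₁ found
... | no  none  = inj₂ λ {e} e∈A → decidable-stable (e ∈? B) (λ e∉B → none (e , e∈A , e∉B))

subset-induction : (P : Subset n → Set ℓ) → P ∅ →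
                   ∀ B → (∀ {A} x → x ∈ B → P A → P (A ∪ ⁅ x ⁆)) → P B
subset-induction P base [] step = base
subset-induction P base (outside ∷ B) step =
  subset-induction (P ∘ (outside ∷_)) base B
    (λ {A} x x∈B → step {outside ∷ A} (Fin.suc x) (there x∈B))
subset-induction P base (inside ∷ B) step =
  -- The head element is inserted last: `(outside ∷ B) ∪ ⁅ zero ⁆` computes to `inside ∷ (B ∪ ∅)`.
  subst (P ∘ (inside ∷_)) (∪-identityʳ B)
    (step {outside ∷ B} Fin.zero here
      (subset-induction (P ∘ (outside ∷_)) base B
        (λ {A} x x∈B → step {outside ∷ A} (Fin.suc x) (there x∈B))))

-- Only deletions of single elements are tested. For the predicates used below, which pass to
-- supersets, this is minimality under inclusion.
Minimal : (Subset n → Set) → Subset n → Set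
Minimal P B = P B × (∀ {x} → x ∈ B → ¬ P (B - x))

minimal-subset : {P : Subset n → Set} → Decidable P →
                 ∀ A → P A → ∃[ B ] B ⊆ A × Minimal P B
minimal-subset {P = P} P? A = go ∣ A ∣ A ≤-refl
  where
  go : ∀ k A → ∣ A ∣ ≤ k → P A → ∃[ B ] B ⊆ A × Minimal P B
  go k A ∣A∣≤k PA with any? (λ x → (x ∈? A) ×-dec P? (A - x))
  ... | no none = A , id , PA , λ x∈A PA-x → none (_ , x∈A , PA-x)
  go zero A ∣A∣≤k PA | yes (x , x∈A , _) = contradiction (≤-trans (x∈p⇒∣p-x∣<∣p∣ x∈A) ∣A∣≤k) λ ()
  go (suc k) A ∣A∣≤k PA | yes (x , x∈A , PA-x) =
    let B , B⊆A-x , minimal = go k (A - x) (s≤s⁻¹ (≤-trans (x∈p⇒∣p-x∣<∣p∣ x∈A) ∣A∣≤k)) PA-x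
    in B , ∈-remove⁻ ∘ B⊆A-x , minimal

does⇒holds : ∀ {a} {A : Set a} (A? : Dec A) → does A? ≡ true → A
does⇒holds (yes a) _ = a

-- Rank, closure, hyperplanes and pencils.

module MatroidProperties (M : Matroid n) where

  open Matroid M renaming (rank to r)
  open ≤-Reasoning

  R : ℕ
  R = r full

  r≤R : ∀ {A} → r A ≤ R
  r≤R = monotone ⊆⊤

  -- Submodularity up to inclusions, so that unions and intersections need not be computed exactly.
  submodular′ : ∀ {A B U V} → U ⊆ A ∪ B → V ⊆ A → V ⊆ B → r U + r V ≤ r A + r B
  submodular′ {A} {B} U⊆A∪B V⊆A V⊆B =
    ≤-trans (+-mono-≤ (monotone U⊆A∪B) (monotone (λ x∈V → x∈p∩q⁺ (V⊆A x∈V , V⊆B x∈V))))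
            (submodular A B)

  infix 4 _∉cl_
  _∉cl_ : Fin n → Subset n → Set
  e ∉cl A = r A < r (A ∪ ⁅ e ⁆)

  -- Diminishing returns: submodularity for `A ∪ ⁅ e ⁆` and `B`, whose intersection contains `A`.
  ∉cl-anti : ∀ {A B e} → A ⊆ B → e ∉cl B → e ∉cl A
  ∉cl-anti {A} {B} {e} A⊆B e∉clB = +-cancelʳ-< (r B) _ _ (begin-strict
    r A + r B              <⟨ +-monoʳ-< (r A) e∉clB ⟩
    r A + r (B ∪ ⁅ e ⁆)    ≡⟨ +-comm (r A) _ ⟩
    r (B ∪ ⁅ e ⁆) + r A    ≤⟨ submodular′ (∪-least ∈-∪ʳ (∈-∪ˡ ∘ ∈-∪ʳ)) ∈-∪ˡ A⊆B ⟩
    r (A ∪ ⁅ e ⁆) + r B    ∎)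

  r-insert : ∀ {A} e → r (A ∪ ⁅ e ⁆) ≤ 1 + r A
  r-insert {A} e = begin
    r (A ∪ ⁅ e ⁆)          ≤⟨ m≤m+n _ _ ⟩
    r (A ∪ ⁅ e ⁆) + r ∅    ≤⟨ submodular′ (∪-least ∈-∪ʳ ∈-∪ˡ) ⊥⊆ ⊥⊆ ⟩
    r ⁅ e ⁆ + r A          ≤⟨ +-monoˡ-≤ (r A) (bounded ⁅ e ⁆) ⟩
    ∣ ⁅ e ⁆ ∣ + r A        ≡⟨ cong (_+ r A) (∣⁅x⁆∣≡1 e) ⟩
    1 + r A                ∎

  ∉⇒∉cl : ∀ {A F e} → IsFlat F → A ⊆ F → e ∉ F → e ∉cl A
  ∉⇒∉cl flat A⊆F e∉F = ∉cl-anti A⊆F (flat e∉F)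

  -- The elements of `B` are added one at a time. Submodularity for `A ∪ C` and `A ∪ ⁅ x ⁆`, which
  -- both contain `A` and have its rank, shows that the rank does not grow.
  r-spanned : ∀ {A} B → (∀ {e} → e ∈ B → r (A ∪ ⁅ e ⁆) ≤ r A) → r (A ∪ B) ≤ r A
  r-spanned {A} B spanned = subset-induction (λ C → r (A ∪ C) ≤ r A)
    (monotone (∪-least id ⊥⊆)) B λ {C} x x∈B rA∪C≤rA → +-cancelʳ-≤ (r A) _ _ (begin
      r (A ∪ C ∪ ⁅ x ⁆) + r A     ≤⟨ submodular′ (∪-least (∈-∪ˡ ∘ ∈-∪ˡ) (∪-mono ∈-∪ʳ ∈-∪ʳ)) ∈-∪ˡ ∈-∪ˡ ⟩
      r (A ∪ C) + r (A ∪ ⁅ x ⁆)   ≤⟨ +-mono-≤ rA∪C≤rA (spanned x∈B) ⟩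
      r A + r A                   ∎)

  cl : Subset n → Subset n
  cl A = tabulate (λ e → does (r (A ∪ ⁅ e ⁆) ≤? r A))

  ∈-cl⁺ : ∀ {A e} → r (A ∪ ⁅ e ⁆) ≤ r A → e ∈ cl A
  ∈-cl⁺ {A} {e} spanned = lookup⇒[]= e _
    (≡-trans (lookup∘tabulate _ e) (dec-true (_ ≤? _) spanned))

  ∈-cl⁻ : ∀ {A e} → e ∈ cl A → r (A ∪ ⁅ e ⁆) ≤ r A
  ∈-cl⁻ {A} {e} e∈clA = does⇒holds (_ ≤? _) (≡-trans (≡-sym (lookup∘tabulate _ e)) ([]=⇒lookup e∈clA))

  ⊆-cl : ∀ {A} → A ⊆ cl A
  ⊆-cl e∈A = ∈-cl⁺ (monotone (insert-⊆ id e∈A))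

  r-cl : ∀ {A} → r (cl A) ≡ r A
  r-cl {A} = ≤-antisym (≤-trans (monotone ∈-∪ʳ) (r-spanned (cl A) ∈-cl⁻)) (monotone ⊆-cl)

  cl-flat : ∀ A → IsFlat (cl A)
  cl-flat A {e} e∉clA = begin-strict
    r (cl A)            ≡⟨ r-cl ⟩
    r A                 <⟨ ≰⇒> (e∉clA ∘ ∈-cl⁺) ⟩
    r (A ∪ ⁅ e ⁆)       ≤⟨ monotone (∪-mono ⊆-cl id) ⟩
    r (cl A ∪ ⁅ e ⁆)    ∎

  spanned-by : ∀ {A B} → B ⊆ cl A → r (A ∪ B) ≤ r A
  spanned-by {A} {B} B⊆clA = r-spanned B (∈-cl⁻ ∘ B⊆clA)

  ∩-flat : ∀ {A B} → IsFlat A → IsFlat B → IsFlat (A ∩ B)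
  ∩-flat {A} {B} flatA flatB {e} e∉A∩B with e ∈? A
  ... | no  e∉A = ∉⇒∉cl flatA (p∩q⊆p A B) e∉A
  ... | yes e∈A = ∉⇒∉cl flatB (p∩q⊆q A B) (λ e∈B → e∉A∩B (x∈p∩q⁺ (e∈A , e∈B)))

  r<⇒∃ : ∀ {A B} → r B < r A → ∃[ e ] e ∈ A × e ∉ B
  r<⇒∃ {A} {B} rB<rA with ∃-or-⊆ A B
  ... | inj₁ found = found
  ... | inj₂ A⊆B   = contradiction (monotone A⊆B) (<⇒≱ rB<rA)

  -- The proof stored in a hyperplane is irrelevant; it is recovered because the order on natural
  -- numbers is decidable.
  flat : ∀ H → IsFlat (value H)
  flat (A , [ isHyperplane ]) e∉A =
    recompute (_ <? _) (proj₁ {A = IsFlat A} {B = λ _ → 1 + r A ≡ R} isHyperplane e∉A)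

  r-hyperplane : ∀ H → 1 + r (value H) ≡ R
  r-hyperplane (A , [ isHyperplane ]) =
    recompute (_ ≟ _) (proj₂ {A = IsFlat A} {B = λ _ → 1 + r A ≡ R} isHyperplane)

  r-hyperplane-insert : ∀ H {A e} → value H ⊆ A → e ∈ A → e ∉ value H → R ≤ r A
  r-hyperplane-insert H H⊆A e∈A e∉H =
    ≤-trans (≤-reflexive (≡-sym (r-hyperplane H))) (≤-trans (flat H e∉H) (monotone (insert-⊆ H⊆A e∈A)))

  hyperplane : ∀ A → 1 + r A ≡ R → Hyperplane
  hyperplane A 1+rA≡R = cl A , [ cl-flat A , ≡-trans (cong suc r-cl) 1+rA≡R ]

  ∉-hyperplane : ∀ {A e} → e ∉cl A → e ∉ cl A
  ∉-hyperplane e∉clA = <⇒≱ e∉clA ∘ ∈-cl⁻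

  -- Elements of `T` outside the closure of `X ∪ U` are added to `X` until `X ∪ U` has full rank.
  -- Each raises `r (X ∪ U)` by at least one and `r X` by at most one, so the gap `d` between the
  -- two persists.
  grow : ∀ X T U d → X ⊆ T → d + r X ≤ r (X ∪ U) → R ≤ r (T ∪ U) →
         ∃[ G ] X ⊆ G × G ⊆ T × d + r G ≤ R × R ≤ r (G ∪ U)
  grow X₀ T U d X₀⊆T d+rX₀≤ R≤rT∪U = go R X₀ X₀⊆T (m≤m+n R _) d+rX₀≤
    where
    go : ∀ k X → X ⊆ T → R ≤ k + r (X ∪ U) → d + r X ≤ r (X ∪ U) →
         ∃[ G ] X ⊆ G × G ⊆ T × d + r G ≤ R × R ≤ r (G ∪ U)
    go zero X X⊆T R≤ d+rX≤ = X , id , X⊆T , ≤-trans d+rX≤ r≤R , R≤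
    go (suc k) X X⊆T R≤ d+rX≤ with ∃-or-⊆ T (cl (X ∪ U))
    ... | inj₂ T⊆cl = X , id , X⊆T , ≤-trans d+rX≤ r≤R , (begin
      R                  ≤⟨ R≤rT∪U ⟩
      r (T ∪ U)          ≤⟨ monotone (∪-least ∈-∪ʳ (∈-∪ˡ ∘ ∈-∪ʳ)) ⟩
      r ((X ∪ U) ∪ T)    ≤⟨ spanned-by T⊆cl ⟩
      r (X ∪ U)          ∎)
    ... | inj₁ (x , x∈T , x∉cl) =
      let increase = ≤-trans (≰⇒> (x∉cl ∘ ∈-cl⁺))
                             (monotone (insert-⊆ (∪-mono ∈-∪ˡ id) (∈-∪ˡ ∈-insert)))
          G , X∪x⊆G , rest = go k (X ∪ ⁅ x ⁆) (insert-⊆ X⊆T x∈T)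
            (≤-trans R≤ (≤-trans (≤-reflexive (≡-sym (+-suc k _))) (+-monoʳ-≤ k increase)))
            (begin
              d + r (X ∪ ⁅ x ⁆)        ≤⟨ +-monoʳ-≤ d (r-insert x) ⟩
              d + suc (r X)            ≡⟨ +-suc d _ ⟩
              suc (d + r X)            ≤⟨ s≤s d+rX≤ ⟩
              suc (r (X ∪ U))          ≤⟨ increase ⟩
              r ((X ∪ ⁅ x ⁆) ∪ U)      ∎)
      in G , X∪x⊆G ∘ ∈-∪ˡ , rest

  -- The hyperplanes containing G form a pencil (G has corank 2), and i and k
  -- lie in different members of it.
  record Separated (G : Subset n) (i k : Fin n) : Set where
    field
      corank2  : 2 + r G ≡ R
      spanning : R ≤ r ((G ∪ ⁅ i ⁆) ∪ ⁅ k ⁆)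

    1+rGi≡R : 1 + r (G ∪ ⁅ i ⁆) ≡ R
    1+rGi≡R = ≤-antisym
      (≤-trans (s≤s (r-insert i)) (≤-reflexive corank2))
      (≤-trans spanning (r-insert k))

    pencil : Hyperplane
    pencil = hyperplane (G ∪ ⁅ i ⁆) 1+rGi≡R

    G⊆ : G ⊆ value pencil
    G⊆ = ⊆-cl ∘ ∈-∪ˡ

    i∈ : i ∈ value pencil
    i∈ = ⊆-cl ∈-insert

    k∉ : k ∉ value pencil
    k∉ = ∉-hyperplane (≤-trans (≤-reflexive 1+rGi≡R) spanning)

  Separated-sym : ∀ {G i k} → Separated G i k → Separated G k i
  Separated-sym sep = record
    { corank2  = corank2
    ; spanning = ≤-trans spanning (monotone (insert-⊆ (∪-mono ∈-∪ˡ id) (∈-∪ˡ ∈-insert)))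
    }
    where open Separated sep

  -- This is `grow` for the set of `i` and `k` with gap 2. The gap bounds the rank of `G` from
  -- above, and two elements sufficing to complete `G` bounds it from below.
  separate : ∀ {X T i k} → X ⊆ T → i ∉cl X → k ∉cl (X ∪ ⁅ i ⁆) → R ≤ r (T ∪ ⁅ i ⁆) →
             ∃[ G ] X ⊆ G × G ⊆ T × Separated G i k
  separate {X} {T} {i} {k} X⊆T i∉cl k∉cl R≤
    with grow X T (⁅ i ⁆ ∪ ⁅ k ⁆) 2 X⊆T
           (≤-trans (s≤s i∉cl) (≤-trans k∉cl (monotone (∪-least (∪-mono id ∈-∪ˡ) (∈-∪ʳ ∘ ∈-∪ʳ)))))
           (≤-trans R≤ (monotone (∪-mono id ∈-∪ˡ)))
  ... | G , X⊆G , G⊆T , 2+rG≤R , R≤rG∪ =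
    let spanning = ≤-trans R≤rG∪ (monotone (∪-least (∈-∪ˡ ∘ ∈-∪ˡ) (∪-least (∈-∪ˡ ∘ ∈-∪ʳ) ∈-∪ʳ)))
    in G , X⊆G , G⊆T , record
    { corank2  = ≤-antisym 2+rG≤R (≤-trans spanning (≤-trans (r-insert k) (s≤s (r-insert i))))
    ; spanning = spanning
    }

  module _ {G} (corank2 : 2 + r G ≡ R) {P Q : Hyperplane}
           (G⊆P : G ⊆ value P) (G⊆Q : G ⊆ value Q)
           {i} (i∈P : i ∈ value P) (i∉Q : i ∉ value Q) where

    -- `P ∪ Q` has full rank because of `i`, so submodularity bounds the rank of `P ∩ Q` from above;
    -- `G` bounds it from below.
    r-meet : 2 + r (value P ∩ value Q) ≡ R
    r-meet = ≤-antisym (+-cancelˡ-≤ R _ _ (begin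
      R + (2 + r (value P ∩ value Q))                     ≡⟨ +-suc R _ ⟩
      suc (R + (1 + r (value P ∩ value Q)))               ≡⟨ cong suc (+-suc R _) ⟩
      2 + (R + r (value P ∩ value Q))                     ≤⟨ +-monoʳ-≤ 2 (+-monoˡ-≤ _
                                                            (r-hyperplane-insert Q ∈-∪ʳ (∈-∪ˡ i∈P) i∉Q)) ⟩
      2 + (r (value P ∪ value Q) + r (value P ∩ value Q)) ≤⟨ +-monoʳ-≤ 2 (submodular (value P) (value Q)) ⟩
      2 + (r (value P) + r (value Q))                     ≡⟨ cong suc (≡-sym (+-suc _ _)) ⟩
      (1 + r (value P)) + (1 + r (value Q))               ≡⟨ cong₂ _+_ (r-hyperplane P) (r-hyperplane Q) ⟩
      R + R                                               ∎))
      (≤-trans (≤-reflexive (≡-sym corank2))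
               (+-monoʳ-≤ 2 (monotone (λ x∈G → x∈p∩q⁺ (G⊆P x∈G , G⊆Q x∈G)))))

    adjacent : IsFlatOfCorank 2 (value P ∩ value Q)
    adjacent = ∩-flat (flat P) (flat Q) , r-meet

    -- A common element outside the closure of `G` would raise the rank of `P ∩ Q` above that of
    -- `G`.
    pencil-disjoint : ∀ {j} → j ∈ value P → j ∉cl G → j ∉ value Q
    pencil-disjoint {j} j∈P j∉clG j∈Q = <-irrefl ≡-refl (begin-strict
      2 + r G                           <⟨ s≤s (s≤s j∉clG) ⟩
      2 + r (G ∪ ⁅ j ⁆)                 ≤⟨ +-monoʳ-≤ 2 (monotone (insert-⊆
                                             (λ x∈G → x∈p∩q⁺ (G⊆P x∈G , G⊆Q x∈G)) (x∈p∩q⁺ (j∈P , j∈Q)))) ⟩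
      2 + r (value P ∩ value Q)         ≡⟨ ≡-trans r-meet (≡-sym corank2) ⟩
      2 + r G                           ∎)

  ⊆⇒≡-hyperplane : ∀ {H H′ : Hyperplane} → value H ⊆ value H′ → H ≡ H′
  ⊆⇒≡-hyperplane {H} {H′} H⊆H′ = value-injective (⊆-antisym H⊆H′ λ {e} e∈H′ →
    decidable-stable (e ∈? value H) λ e∉H → <-irrefl ≡-refl (begin-strict
      r (value H′)   <⟨ ≤-reflexive (r-hyperplane H′) ⟩
      R              ≤⟨ r-hyperplane-insert H H⊆H′ e∈H′ e∉H ⟩
      r (value H′)   ∎))

⊆-reinsert : ∀ {A : Subset n} x → A ⊆ (A - x) ∪ ⁅ x ⁆
⊆-reinsert x {e} e∈A with e ≟ᶠ x
... | yes ≡-refl = ∈-insert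
... | no  e≢x    = ∈-∪ˡ (x∈p∧x≢y⇒x∈p-y e∈A e≢x)

-- Circuits and connected minors.

module Circuits (M : Matroid n) where

  open Matroid M renaming (rank to r)
  open MatroidProperties M
  open ≤-Reasoning

  -- A circuit is used through two properties: no hyperplane misses exactly one of its elements, and
  -- its proper subsets are independent.
  record Circuit (C : Subset n) : Set where
    field
      dependent   : ∀ {z} (H : Hyperplane) → z ∈ C → (∀ {w} → w ∈ C → w ≢ z → w ∈ value H) → z ∈ value H
      independent : ∀ {z z′ A} → z ∈ C → z′ ∈ C → z ≢ z′ → A ⊆ C → z ∉ A → z′ ∉ A → z ∉cl A

  Dependent : Subset n → Set
  Dependent A = ∃[ z ] z ∈ A × r A ≤ r (A - z)

  dependent? : Decidable Dependent
  dependent? A = any? (λ z → (z ∈? A) ×-dec (r A ≤? r (A - z)))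

  dependent-mono : ∀ {A B} → A ⊆ B → Dependent A → Dependent B
  dependent-mono {A} {B} A⊆B (z , z∈A , rA≤) = z , A⊆B z∈A , +-cancelʳ-≤ (r A) _ _ (begin
    r B + r A          ≤⟨ +-monoʳ-≤ (r B) rA≤ ⟩
    r B + r (A - z)    ≤⟨ submodular′ (∪-least ∈-∪ˡ (⁅⁆-⊆ (∈-∪ʳ z∈A)) ∘ ⊆-reinsert z)
                            (λ x∈A-z → x∈p∧x≢y⇒x∈p-y (A⊆B (∈-remove⁻ x∈A-z)) (∈-remove⇒≢ A x∈A-z))
                            ∈-remove⁻ ⟩
    r (B - z) + r A    ∎)

  independent-insert : ∀ {A x} → ¬ Dependent A → x ∉cl A → ¬ Dependent (A ∪ ⁅ x ⁆)
  independent-insert {A} {x} indep x∉cl (z , z∈Ax , rAx≤) with z ∈? A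
  ... | no z∉A = <-irrefl ≡-refl (begin-strict
      r A                    <⟨ x∉cl ⟩
      r (A ∪ ⁅ x ⁆)          ≤⟨ rAx≤ ⟩
      r (A ∪ ⁅ x ⁆ - z)      ≤⟨ monotone (λ e∈ → [ id , (λ e∈⁅x⁆ → contradiction e∈⁅x⁆
                                  (x≢y⇒x∉⁅y⁆ λ e≡x → ∈-remove⇒≢ (A ∪ ⁅ x ⁆) e∈ (≡-trans e≡x (≡-sym z≡x)))) ]′
                                  (x∈p∪q⁻ A ⁅ x ⁆ (∈-remove⁻ e∈))) ⟩
      r A                    ∎)
    where
    z≡x : z ≡ x
    z≡x = [ (λ z∈A → contradiction z∈A z∉A) , x∈⁅y⁆⇒x≡y x ]′ (x∈p∪q⁻ A ⁅ x ⁆ z∈Ax)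
  ... | yes z∈A = <-irrefl ≡-refl (begin-strict
      r (A ∪ ⁅ x ⁆)          ≤⟨ rAx≤ ⟩
      r (A ∪ ⁅ x ⁆ - z)      ≤⟨ monotone (λ e∈ → [ (λ e∈A → ∈-∪ˡ (x∈p∧x≢y⇒x∈p-y e∈A (∈-remove⇒≢ (A ∪ ⁅ x ⁆) e∈))) , ∈-∪ʳ ]′
                                  (x∈p∪q⁻ A ⁅ x ⁆ (∈-remove⁻ e∈))) ⟩
      r ((A - z) ∪ ⁅ x ⁆)    ≤⟨ r-insert x ⟩
      1 + r (A - z)          ≤⟨ ≰⇒> (λ rA≤ → indep (z , z∈A , rA≤)) ⟩
      r A                    <⟨ x∉cl ⟩
      r (A ∪ ⁅ x ⁆)          ∎)

  -- By minimality every `C - z′` is independent. Hence `C - z₀` and `C - z` both have rank one more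
  -- than `C - z₀ - z`, and the dependence at `z₀` carries over to every other `z`.
  minimal-dependent⇒circuit : ∀ {C} → Minimal Dependent C → Circuit C
  minimal-dependent⇒circuit {C} ((z₀ , z₀∈C , rC≤) , minimal) = record
    { dependent   = λ {z} H z∈C C-z⊆H → decidable-stable (z ∈? value H) λ z∉H →
        <-irrefl ≡-refl (begin-strict
          r (C - z)               <⟨ ∉⇒∉cl (flat H) (λ w∈ → C-z⊆H (∈-remove⁻ w∈) (∈-remove⇒≢ C w∈)) z∉H ⟩
          r ((C - z) ∪ ⁅ z ⁆)     ≤⟨ monotone (insert-⊆ ∈-remove⁻ z∈C) ⟩
          r C                     ≤⟨ spanned z∈C ⟩
          r (C - z)               ∎)
    ; independent = λ {z} {z′} {A} z∈C z′∈C z≢z′ A⊆C z∉A z′∉A →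
        ∉cl-anti (λ {w} w∈A → x∈p∧x≢y⇒x∈p-y (x∈p∧x≢y⇒x∈p-y (A⊆C w∈A) (∈-∉⇒≢ w∈A z′∉A)) (∈-∉⇒≢ w∈A z∉A))
          (≤-trans (two z∈C z′∈C z≢z′) (monotone (⊆-reinsert z)))
    }
    where
    two : ∀ {z z′} → z ∈ C → z′ ∈ C → z ≢ z′ → r (C - z′ - z) < r (C - z′)
    two z∈C z′∈C z≢z′ = ≰⇒> λ r≤ → minimal z′∈C (_ , x∈p∧x≢y⇒x∈p-y z∈C z≢z′ , r≤)

    spanned : ∀ {z} → z ∈ C → r C ≤ r (C - z)
    spanned {z} z∈C with z ≟ᶠ z₀
    ... | yes ≡-refl = rC≤
    ... | no  z≢z₀   = begin
      r C                          ≤⟨ rC≤ ⟩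
      r (C - z₀)                   ≤⟨ monotone (⊆-reinsert z) ⟩
      r ((C - z₀ - z) ∪ ⁅ z ⁆)     ≤⟨ r-insert z ⟩
      1 + r (C - z₀ - z)           ≡⟨ cong (suc ∘ r) (p─x─y≡p─y─x C z₀ z) ⟩
      1 + r (C - z - z₀)           ≤⟨ two z₀∈C z∈C (z≢z₀ ∘ ≡-sym) ⟩
      r (C - z)                    ∎

  -- `I` is a basis of `H`. Adding both `x` and `y` makes it dependent, since one of them already
  -- gives full rank; adding only one keeps it independent, so a minimal dependent subset contains
  -- both.
  fundamental-circuit : ∀ H {x y} → x ∉ value H → y ∉ value H → x ≢ y →
    ∃[ C ] Circuit C × x ∈ C × y ∈ C × (∀ {z} → z ∈ C → z ≢ x → z ≢ y → z ∈ value H)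
  fundamental-circuit H {x} {y} x∉H y∉H x≢y
    with minimal-subset {P = λ A → r (value H) ≤ r A} (λ _ → _ ≤? _) (value H) ≤-refl
  ... | I , I⊆H , rH≤rI , minimal
    with minimal-subset dependent? ((I ∪ ⁅ x ⁆) ∪ ⁅ y ⁆) (y , ∈-insert , (begin
           r ((I ∪ ⁅ x ⁆) ∪ ⁅ y ⁆)       ≤⟨ r≤R ⟩
           R                             ≡⟨ r-hyperplane H ⟨
           1 + r (value H)               ≤⟨ s≤s rH≤rI ⟩
           1 + r I                       ≤⟨ ∉⇒∉cl (flat H) I⊆H x∉H ⟩
           r (I ∪ ⁅ x ⁆)                 ≤⟨ monotone (λ e∈ → x∈p∧x≢y⇒x∈p-y (∈-∪ˡ e∈)
                                              (∈-∉⇒≢ e∈ (∉-insert (y∉H ∘ I⊆H) (x≢y ∘ ≡-sym)))) ⟩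
           r ((I ∪ ⁅ x ⁆) ∪ ⁅ y ⁆ - y)   ∎))
  ... | C , C⊆Ixy , minimal-dependent@(dep , _) =
    C , minimal-dependent⇒circuit minimal-dependent
      , decidable-stable (x ∈? C) (λ x∉C → insert-independent y∉H (dependent-mono (drop-x x∉C) dep))
      , decidable-stable (y ∈? C) (λ y∉C → insert-independent x∉H (dependent-mono (drop-y y∉C) dep))
      , λ z∈C z≢x z≢y → [ I⊆H , [ (λ z≡x → contradiction z≡x z≢x) , (λ z≡y → contradiction z≡y z≢y) ]′ ]′
                          (split (C⊆Ixy z∈C))
    where
    split : ∀ {z} → z ∈ (I ∪ ⁅ x ⁆) ∪ ⁅ y ⁆ → z ∈ I ⊎ (z ≡ x ⊎ z ≡ y)
    split z∈ with x∈p∪q⁻ (I ∪ ⁅ x ⁆) ⁅ y ⁆ z∈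
    ... | inj₂ z∈⁅y⁆ = inj₂ (inj₂ (x∈⁅y⁆⇒x≡y y z∈⁅y⁆))
    ... | inj₁ z∈Ix with x∈p∪q⁻ I ⁅ x ⁆ z∈Ix
    ... | inj₁ z∈I   = inj₁ z∈I
    ... | inj₂ z∈⁅x⁆ = inj₂ (inj₁ (x∈⁅y⁆⇒x≡y x z∈⁅x⁆))

    drop-x : x ∉ C → C ⊆ I ∪ ⁅ y ⁆
    drop-x x∉C z∈C with split (C⊆Ixy z∈C)
    ... | inj₁ z∈I           = ∈-∪ˡ z∈I
    ... | inj₂ (inj₁ ≡-refl) = contradiction z∈C x∉C
    ... | inj₂ (inj₂ ≡-refl) = ∈-insert

    drop-y : y ∉ C → C ⊆ I ∪ ⁅ x ⁆
    drop-y y∉C z∈C with split (C⊆Ixy z∈C)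
    ... | inj₁ z∈I           = ∈-∪ˡ z∈I
    ... | inj₂ (inj₁ ≡-refl) = ∈-insert
    ... | inj₂ (inj₂ ≡-refl) = contradiction z∈C y∉C

    insert-independent : ∀ {w} → w ∉ value H → ¬ Dependent (I ∪ ⁅ w ⁆)
    insert-independent w∉H = independent-insert
      (λ (z , z∈I , rI≤) → minimal z∈I (≤-trans rH≤rI rI≤)) (∉⇒∉cl (flat H) I⊆H w∉H)

  -- In the contraction of `K`, the ranks of `A` and `B` add up to at most that of `S`. The parts
  -- may overlap; in particular a loop of the minor always gives a separation.
  Separation : Subset n → Subset n → Set
  Separation K S = ∃[ A ] ∃[ B ] A ⊆ S × B ⊆ S × S ⊆ A ∪ B × Nonempty A × Nonempty B ×
                   r (A ∪ K) + r (B ∪ K) ≤ r (S ∪ K) + r K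

  separation? : ∀ K S → Dec (Separation K S)
  separation? K S = anySubset? λ A → anySubset? λ B →
    (A ⊆? S) ×-dec (B ⊆? S) ×-dec (S ⊆? A ∪ B) ×-dec nonempty? A ×-dec nonempty? B ×-dec (_ ≤? _)

  -- Connectedness of the minor of M on S obtained by contracting K and
  -- deleting all other elements.
  Connected : Subset n → Subset n → Set
  Connected K S = ¬ Separation K S

  connected-< : ∀ {K S} → Connected K S → ∀ A B → A ⊆ S → B ⊆ S → S ⊆ A ∪ B →
                Nonempty A → Nonempty B → r (S ∪ K) + r K < r (A ∪ K) + r (B ∪ K)
  connected-< conn A B A⊆S B⊆S S⊆A∪B a b = ≰⇒> λ r≤ → conn (A , B , A⊆S , B⊆S , S⊆A∪B , a , b , r≤)

  module _ {K S x} (x∈S : x ∈ S) (conn : Connected K S)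
           {A B A′ B′} (A⊆ : A ⊆ S - x) (B⊆ : B ⊆ S - x) (A′⊆ : A′ ⊆ S - x) (B′⊆ : B′ ⊆ S - x)
           (cover : S - x ⊆ A ∪ B) (cover′ : S - x ⊆ A′ ∪ B′)
           (r≤ : r (A ∪ K) + r (B ∪ K) ≤ r ((S - x) ∪ K) + r K)
           (r≤′ : r (A′ ∪ K ∪ ⁅ x ⁆) + r (B′ ∪ K ∪ ⁅ x ⁆) ≤ r ((S - x) ∪ K ∪ ⁅ x ⁆) + r (K ∪ ⁅ x ⁆))
           where

    -- `(A , B)` separates the deletion of `x` and `(A′ , B′)` the contraction. Connectedness yields
    -- a strict inequality for `A ∩ A′` against `B ∪ B′ ∪ ⁅ x ⁆` and one for `B ∩ B′` against
    -- `A ∪ A′ ∪ ⁅ x ⁆`. Together they exceed by one what submodularity and the two separations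
    -- allow; contracting `x` accounts for only one unit of rank.
    uncross : Nonempty (A ∩ A′) → ¬ Nonempty (B ∩ B′)
    uncross nonempty nonempty′ = <-irrefl ≡-refl (begin-strict
      (s + k) + (1 + (s + k))                   <⟨ +-mono-<-≤
        (connected-< conn (A ∩ A′) (B ∪ B′ ∪ ⁅ x ⁆) (∈-remove⁻ ∘ A⊆ ∘ p∩q⊆p A A′)
          (∪-least (∈-remove⁻ ∘ B⊆) (∪-least (∈-remove⁻ ∘ B′⊆) (⁅⁆-⊆ x∈S)))
          (covers cover cover′) nonempty (x , ∈-∪ʳ (∈-∪ʳ (x∈⁅x⁆ x))))
        (connected-< conn (B ∩ B′) (A ∪ A′ ∪ ⁅ x ⁆) (∈-remove⁻ ∘ B⊆ ∘ p∩q⊆p B B′)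
          (∪-least (∈-remove⁻ ∘ A⊆) (∪-least (∈-remove⁻ ∘ A′⊆) (⁅⁆-⊆ x∈S)))
          (covers (swap A B cover) (swap A′ B′ cover′)) nonempty′ (x , ∈-∪ʳ (∈-∪ʳ (x∈⁅x⁆ x)))) ⟩
      (a∩ + b∪) + (b∩ + a∪)                     ≡⟨ rearrange₁ a∩ b∪ b∩ a∪ ⟩
      (a∪ + a∩) + (b∪ + b∩)                     ≤⟨ +-mono-≤ (meet-join A A′) (meet-join B B′) ⟩
      (a + a′) + (b + b′)                       ≡⟨ rearrange₂ a a′ b b′ ⟩
      (a + b) + (a′ + b′)                       ≤⟨ +-mono-≤
        (≤-trans r≤ (+-monoˡ-≤ k (monotone (∪-mono ∈-remove⁻ id))))
        (≤-trans r≤′ (+-mono-≤ (monotone (∪-least (∈-∪ˡ ∘ ∈-remove⁻) (insert-⊆ ∈-∪ʳ (∈-∪ˡ x∈S)))) (r-insert x))) ⟩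
      (s + k) + (s + (1 + k))                   ≡⟨ cong ((s + k) +_) (+-suc s k) ⟩
      (s + k) + (1 + (s + k))                   ∎)
      where
      s  = r (S ∪ K)
      k  = r K
      a  = r (A ∪ K)
      b  = r (B ∪ K)
      a′ = r (A′ ∪ K ∪ ⁅ x ⁆)
      b′ = r (B′ ∪ K ∪ ⁅ x ⁆)
      a∩ = r ((A ∩ A′) ∪ K)
      b∩ = r ((B ∩ B′) ∪ K)
      a∪ = r ((A ∪ A′ ∪ ⁅ x ⁆) ∪ K)
      b∪ = r ((B ∪ B′ ∪ ⁅ x ⁆) ∪ K)
      rearrange₁ : ∀ p q u v → (p + q) + (u + v) ≡ (v + p) + (q + u)
      rearrange₁ = solve-∀
      rearrange₂ : ∀ p q u v → (p + q) + (u + v) ≡ (p + u) + (q + v)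
      rearrange₂ = solve-∀
      meet-join : ∀ X X′ → r ((X ∪ X′ ∪ ⁅ x ⁆) ∪ K) + r ((X ∩ X′) ∪ K) ≤ r (X ∪ K) + r (X′ ∪ K ∪ ⁅ x ⁆)
      meet-join X X′ = submodular′
        (∪-least (∪-mono ∈-∪ˡ (∪-mono id ∈-∪ʳ)) (∈-∪ˡ ∘ ∈-∪ʳ))
        (∪-mono (p∩q⊆p X X′) id) (∪-mono (p∩q⊆q X X′) ∈-∪ˡ)
      swap : ∀ X Y → S - x ⊆ X ∪ Y → S - x ⊆ Y ∪ X
      swap X Y c = ∪-least ∈-∪ʳ ∈-∪ˡ ∘ c
      covers : ∀ {X Y X′ Y′} → S - x ⊆ X ∪ Y → S - x ⊆ X′ ∪ Y′ → S ⊆ (X ∩ X′) ∪ Y ∪ Y′ ∪ ⁅ x ⁆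
      covers {X} {Y} {X′} {Y′} c c′ {e} e∈S with e ≟ᶠ x
      ... | yes ≡-refl = ∈-∪ʳ (∈-∪ʳ ∈-insert)
      ... | no  e≢x    = let e∈ = x∈p∧x≢y⇒x∈p-y e∈S e≢x in
        [ (λ e∈X → [ (λ e∈X′ → ∈-∪ˡ (x∈p∩q⁺ (e∈X , e∈X′)))
                   , (λ e∈Y′ → ∈-∪ʳ (∈-∪ʳ (∈-∪ˡ e∈Y′))) ]′ (x∈p∪q⁻ X′ Y′ (c′ e∈)))
        , (λ e∈Y → ∈-∪ʳ (∈-∪ˡ e∈Y)) ]′ (x∈p∪q⁻ X Y (c e∈))

  -- Two separations always cross in one of the two ways of matching their parts: if `A ∩ A′` is
  -- empty, then `A ⊆ B′` and `A′ ⊆ B`, so `A ∩ B′` and `B ∩ A′` are nonempty; likewise if `B ∩ B′`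
  -- is empty.
  connected-remove : ∀ {K S x} → x ∈ S → Connected K S →
                     Connected K (S - x) ⊎ Connected (K ∪ ⁅ x ⁆) (S - x)
  connected-remove {K} {S} {x} x∈S conn with separation? K (S - x) | separation? (K ∪ ⁅ x ⁆) (S - x)
  ... | no  conn-del | _            = inj₁ conn-del
  ... | yes _        | no conn-con  = inj₂ conn-con
  ... | yes (A , B , A⊆ , B⊆ , cover , (a , a∈A) , (b , b∈B) , r≤)
      | yes (A′ , B′ , A′⊆ , B′⊆ , cover′ , (a′ , a′∈A′) , (b′ , b′∈B′) , r≤′)
    with nonempty? (A ∩ A′) | nonempty? (B ∩ B′)
  ... | yes nonempty | yes nonempty′ =
    contradiction nonempty′ (uncross x∈S conn A⊆ B⊆ A′⊆ B′⊆ cover cover′ r≤ r≤′ nonempty)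
  ... | no empty | _ =
    contradiction (a′ , x∈p∩q⁺ (∈-∪-∉ˡ A B (cover (A′⊆ a′∈A′)) (λ a′∈A → empty (a′ , x∈p∩q⁺ (a′∈A , a′∈A′))) , a′∈A′))
      (uncross x∈S conn A⊆ B⊆ B′⊆ A′⊆ cover (∪-least ∈-∪ʳ ∈-∪ˡ ∘ cover′) r≤
        (≤-trans (≤-reflexive (+-comm (r (B′ ∪ K ∪ ⁅ x ⁆)) _)) r≤′)
        (a , x∈p∩q⁺ (a∈A , ∈-∪-∉ˡ A′ B′ (cover′ (A⊆ a∈A)) (λ a∈A′ → empty (a , x∈p∩q⁺ (a∈A , a∈A′))))))
  ... | _ | no empty =
    contradiction (b , x∈p∩q⁺ (b∈B , ∈-∪-∉ʳ A′ B′ (cover′ (B⊆ b∈B)) (λ b∈B′ → empty (b , x∈p∩q⁺ (b∈B , b∈B′)))))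
      (uncross x∈S conn A⊆ B⊆ B′⊆ A′⊆ cover (∪-least ∈-∪ʳ ∈-∪ˡ ∘ cover′) r≤
        (≤-trans (≤-reflexive (+-comm (r (B′ ∪ K ∪ ⁅ x ⁆)) _)) r≤′)
        (b′ , x∈p∩q⁺ (∈-∪-∉ʳ A B (cover (B′⊆ b′∈B′)) (λ b′∈B → empty (b′ , x∈p∩q⁺ (b′∈B , b′∈B′))) , b′∈B′)))

  connected-minor : ∀ {K S T} → T ⊆ S → Connected K S → ∃[ K′ ] Connected K′ T
  connected-minor {K} {S} {T} T⊆S conn = go ∣ S ∣ K S ≤-refl T⊆S conn
    where
    go : ∀ k K S → ∣ S ∣ ≤ k → T ⊆ S → Connected K S → ∃[ K′ ] Connected K′ T
    go k K S ∣S∣≤k T⊆S conn with ∃-or-⊆ S T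
    ... | inj₂ S⊆T = K , subst (Connected K) (⊆-antisym S⊆T T⊆S) conn
    go zero K S ∣S∣≤k T⊆S conn | inj₁ (x , x∈S , _) =
      contradiction (≤-trans (x∈p⇒∣p-x∣<∣p∣ x∈S) ∣S∣≤k) λ ()
    go (suc k) K S ∣S∣≤k T⊆S conn | inj₁ (x , x∈S , x∉T) =
      [ go k K (S - x) smaller T⊆S-x , go k (K ∪ ⁅ x ⁆) (S - x) smaller T⊆S-x ]′ (connected-remove x∈S conn)
      where
      smaller : ∣ S - x ∣ ≤ k
      smaller = s≤s⁻¹ (≤-trans (x∈p⇒∣p-x∣<∣p∣ x∈S) ∣S∣≤k)
      T⊆S-x : T ⊆ S - x
      T⊆S-x e∈T = x∈p∧x≢y⇒x∈p-y (T⊆S e∈T) (∈-∉⇒≢ e∈T x∉T)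

  -- The complements of `H` and `H′` are cocircuits sharing `f`, with union `∁ K`. An element of the
  -- part opposite to `f` lies in one of them, so a separation would split that cocircuit.
  cocircuits-connected : ∀ H H′ {f} → f ∉ value H → f ∉ value H′ →
                         Connected (value H ∩ value H′) (∁ (value H ∩ value H′))
  cocircuits-connected H H′ {f} f∉H f∉H′ (A , B , A⊆ , B⊆ , cover , (a , a∈A) , (b , b∈B) , r≤) =
    [ (λ f∈A → [ (λ b∉H → split H (p∩q⊆p _ _) f∈A f∉H b∈B b∉H)
               , (λ b∉H′ → split H′ (p∩q⊆q _ _) f∈A f∉H′ b∈B b∉H′) ]′ (∁-∩ (B⊆ b∈B)))
    , (λ f∈B → [ (λ a∉H → split H (p∩q⊆p _ _) a∈A a∉H f∈B f∉H)
               , (λ a∉H′ → split H′ (p∩q⊆q _ _) a∈A a∉H′ f∈B f∉H′) ]′ (∁-∩ (A⊆ a∈A)))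
    ]′ (x∈p∪q⁻ A B (cover (x∉p⇒x∈∁p (f∉H ∘ p∩q⊆p _ _))))
    where
    K : Subset n
    K = value H ∩ value H′
    ∁-∩ : ∀ {e} → e ∈ ∁ K → e ∉ value H ⊎ e ∉ value H′
    ∁-∩ {e} e∈∁K with e ∈? value H
    ... | no  e∉H = inj₁ e∉H
    ... | yes e∈H = inj₂ λ e∈H′ → x∈∁p⇒x∉p e∈∁K (x∈p∩q⁺ (e∈H , e∈H′))
    -- Intersecting with `Q` lowers the rank of both `A ∪ K` and `B ∪ K`, a total loss of at least
    -- 2, although `Q` has corank 1.
    split : ∀ Q → K ⊆ value Q → ∀ {a b} → a ∈ A → a ∉ value Q → b ∈ B → ¬ (b ∉ value Q)
    split Q K⊆Q {a} {b} a∈A a∉Q b∈B b∉Q = <-irrefl ≡-refl (begin-strict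
      1 + (r (value Q) + r K)                                    ≤⟨ s≤s (submodular′ cover-Q
                                                                     (λ e∈K → x∈p∩q⁺ (∈-∪ʳ e∈K , K⊆Q e∈K))
                                                                     (λ e∈K → x∈p∩q⁺ (∈-∪ʳ e∈K , K⊆Q e∈K))) ⟩
      1 + (r ((A ∪ K) ∩ value Q) + r ((B ∪ K) ∩ value Q))        <⟨ s≤s (+-mono-<-≤ (drop (∈-∪ˡ a∈A) a∉Q)  ≤-refl) ⟩
      1 + (r (A ∪ K) + r ((B ∪ K) ∩ value Q))                    ≡⟨ +-suc _ _ ⟨
      r (A ∪ K) + suc (r ((B ∪ K) ∩ value Q))                    ≤⟨ +-monoʳ-≤ _ (drop (∈-∪ˡ b∈B) b∉Q) ⟩
      r (A ∪ K) + r (B ∪ K)                                      ≤⟨ r≤ ⟩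
      r (∁ K ∪ K) + r K                                          ≤⟨ +-monoˡ-≤ (r K) r≤R ⟩
      R + r K                                                    ≡⟨ cong (_+ r K) (r-hyperplane Q) ⟨
      1 + (r (value Q) + r K)                                    ∎)
      where
      drop : ∀ {X e} → e ∈ X → e ∉ value Q → r (X ∩ value Q) < r X
      drop {X} e∈X e∉Q = ≤-trans (∉⇒∉cl (flat Q) (p∩q⊆q X (value Q)) e∉Q)
                                 (monotone (insert-⊆ (p∩q⊆p X (value Q)) e∈X))
      cover-Q : value Q ⊆ ((A ∪ K) ∩ value Q) ∪ ((B ∪ K) ∩ value Q)
      cover-Q {e} e∈Q with e ∈? K
      ... | yes e∈K = ∈-∪ˡ (x∈p∩q⁺ (∈-∪ʳ e∈K , e∈Q))
      ... | no  e∉K = [ (λ e∈A → ∈-∪ˡ (x∈p∩q⁺ (∈-∪ˡ e∈A , e∈Q))) , (λ e∈B → ∈-∪ʳ (x∈p∩q⁺ (∈-∪ˡ e∈B , e∈Q))) ]′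
        (x∈p∪q⁻ A B (cover (x∉p⇒x∈∁p e∉K)))

-- Ratios modulo cross-ratios: independence of the hyperplane and existence of a potential.

module Ratios (M : Matroid n) (𝔾 : Group ℓ₁ ℓ) where

  open Matroid M renaming (rank to r)
  open MatroidProperties M
  open Circuits M
  open Group 𝔾 hiding (_-_)
  open GroupProperties 𝔾

  -- q H e f plays the role of φ_H(e) / φ_H(f) modulo cross-ratios.
  module _ (q : Hyperplane → Fin n → Fin n → Carrier)
           (q-trans : ∀ H e f g → q H e f ∙ q H f g ≈ q H e g)
           (q-adjacent : ∀ H₁ H₂ → IsFlatOfCorank 2 (value H₁ ∩ value H₂) → ∀ {e f} →
             e ∉ value H₁ → f ∉ value H₁ → e ∉ value H₂ → f ∉ value H₂ → q H₁ e f ≈ q H₂ e f)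
           (q-hexagon : ∀ H₁ H₂ H₃ → IsFlatOfCorank 2 (value H₁ ∩ value H₂ ∩ value H₃) → ∀ {e₁ e₂ e₃} →
             e₁ ∈ value H₁ → e₁ ∉ value H₂ → e₁ ∉ value H₃ →
             e₂ ∉ value H₁ → e₂ ∈ value H₂ → e₂ ∉ value H₃ →
             e₃ ∉ value H₁ → e₃ ∉ value H₂ → e₃ ∈ value H₃ →
             q H₃ e₁ e₂ ∙ q H₁ e₂ e₃ ≈ q H₂ e₁ e₃)
           where

    q-refl : ∀ H e → q H e e ≈ ε
    q-refl H e = identityʳ-unique _ _ (q-trans H e e e)

    q-sym : ∀ H e f → q H e f ≈ q H f e ⁻¹
    q-sym H e f = inverseˡ-unique _ _ (trans (q-trans H e f e) (q-refl H e))

    -- `H′` is moved towards `H₀` among the hyperplanes through `K` avoiding `x`, and hence `y`.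
    -- Each move is to an adjacent hyperplane containing `H₀ ∩ H′` and one more element of `H₀`; `k`
    -- bounds the corank of `H₀ ∩ H′`.
    q-parallel : ∀ {K x y} → (∀ H → K ⊆ value H → x ∉ value H → y ∉ value H) → ∀ H H′ →
                 K ⊆ value H → K ⊆ value H′ → x ∉ value H → x ∉ value H′ → q H x y ≈ q H′ x y
    q-parallel {K} {x} {y} parallel H₀ H′ K⊆H₀ K⊆H′ x∉H₀ x∉H′ = go R H′ (m≤m+n R _) K⊆H′ x∉H′
      where
      go : ∀ k H′ → R ≤ k + r (value H₀ ∩ value H′) → K ⊆ value H′ → x ∉ value H′ →
           q H₀ x y ≈ q H′ x y
      go k H′ R≤ K⊆H′ x∉H′ with ∃-or-⊆ (value H₀) (value H′)
      ... | inj₂ H₀⊆H′ with ≡-refl ← ⊆⇒≡-hyperplane {H₀} {H′} H₀⊆H′ = refl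
      go zero H′ R≤ K⊆H′ x∉H′ | inj₁ _ =
        contradiction (≤-trans R≤ (monotone (p∩q⊆p (value H₀) (value H′)))) (<⇒≱ (≤-reflexive (r-hyperplane H₀)))
      go (suc k) H′ R≤ K⊆H′ x∉H′ | inj₁ (p , p∈H₀ , p∉H′)
        -- Both `H₀ ∩ H′` and `p` lie in `H₀`, which avoids `x`; so the new hyperplane through `p`
        -- can be chosen to avoid `x`.
        with separate {k = x} (p∩q⊆q (value H₀) (value H′))
               (∉⇒∉cl (flat H′) (p∩q⊆q (value H₀) (value H′)) p∉H′)
               (∉⇒∉cl (flat H₀) (insert-⊆ (p∩q⊆p (value H₀) (value H′)) p∈H₀) x∉H₀)
               (r-hyperplane-insert H′ ∈-∪ˡ ∈-insert p∉H′)
      ... | G , X⊆G , G⊆H′ , sep =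
        trans (go k pencil closer K⊆pencil k∉)
              (q-adjacent pencil H′ (adjacent corank2 {pencil} {H′} G⊆ G⊆H′ i∈ p∉H′)
                k∉ (parallel pencil K⊆pencil k∉) x∉H′ (parallel H′ K⊆H′ x∉H′))
        where
        open Separated sep
        open ≤-Reasoning
        K⊆pencil : K ⊆ value pencil
        K⊆pencil e∈K = G⊆ (X⊆G (x∈p∩q⁺ (K⊆H₀ e∈K , K⊆H′ e∈K)))
        closer : R ≤ k + r (value H₀ ∩ value pencil)
        closer = begin
          R                                                   ≤⟨ R≤ ⟩
          suc k + r (value H₀ ∩ value H′)                     ≡⟨ +-suc k _ ⟨
          k + suc (r (value H₀ ∩ value H′))                   ≤⟨ +-monoʳ-≤ k (∉⇒∉cl (flat H′) (p∩q⊆q (value H₀) (value H′)) p∉H′) ⟩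
          k + r ((value H₀ ∩ value H′) ∪ ⁅ p ⁆)               ≤⟨ +-monoʳ-≤ k (monotone (insert-⊆
                                                                   (λ e∈ → x∈p∩q⁺ (p∩q⊆p (value H₀) (value H′) e∈ , G⊆ (X⊆G e∈)))
                                                                   (x∈p∩q⁺ (p∈H₀ , i∈)))) ⟩
          k + r (value H₀ ∩ value pencil)                     ∎

    record Triangle (K : Subset n) (e f g : Fin n) : Set ℓ where
      field
        He Hf Hg : Hyperplane
        K⊆He : K ⊆ value He
        K⊆Hf : K ⊆ value Hf
        K⊆Hg : K ⊆ value Hg
        e∈He : e ∈ value He
        e∉Hf : e ∉ value Hf
        e∉Hg : e ∉ value Hg
        f∉He : f ∉ value He
        f∈Hf : f ∈ value Hf
        f∉Hg : f ∉ value Hg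
        g∉He : g ∉ value He
        g∉Hf : g ∉ value Hf
        g∈Hg : g ∈ value Hg
        hexagon : q Hg e f ∙ q He f g ≈ q Hf e g

    -- A corank 2 flat over `K` separates `e` from `f`, so no member of its pencil contains both. A
    -- member containing `g` and one of them would contain the other, so `e`, `f` and `g` lie in
    -- three different members.
    q-triangle : ∀ {K e f g} → e ∉cl K → f ∉cl (K ∪ ⁅ e ⁆) →
      (∀ (H : Hyperplane) → K ⊆ value H → e ∈ value H → f ∈ value H → g ∈ value H) →
      (∀ (H : Hyperplane) → K ⊆ value H → e ∈ value H → g ∈ value H → f ∈ value H) →
      (∀ (H : Hyperplane) → K ⊆ value H → f ∈ value H → g ∈ value H → e ∈ value H) →
      Triangle K e f g
    q-triangle {K} {e} {f} {g} e∉cl f∉cl ef⇒g eg⇒f fg⇒e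
      with separate ⊆⊤ e∉cl f∉cl (monotone ∈-∪ˡ)
    ... | G , K⊆G , _ , ef =
      record
        { He = E.pencil ; Hf = F.pencil ; Hg = G.pencil
        ; K⊆He = E.G⊆ ∘ K⊆G ; K⊆Hf = F.G⊆ ∘ K⊆G ; K⊆Hg = G.G⊆ ∘ K⊆G
        ; e∈He = E.i∈ ; e∉Hf = F.k∉ ; e∉Hg = G.k∉
        ; f∉He = E.k∉ ; f∈Hf = F.i∈ ; f∉Hg = f∉G
        ; g∉He = g∉E ; g∉Hf = g∉F ; g∈Hg = G.i∈
        ; hexagon =
      q-hexagon E.pencil F.pencil G.pencil
        ( ∩-flat (flat E.pencil) (∩-flat (flat F.pencil) (flat G.pencil))
        , ≤-antisym
            (≤-trans (+-monoʳ-≤ 2 (monotone (p∩q⊆q (value E.pencil) (value F.pencil ∩ value G.pencil))))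
                     (≤-reflexive (r-meet E.corank2 {F.pencil} {G.pencil} F.G⊆ G.G⊆ F.i∈ f∉G)))
            (≤-trans (≤-reflexive (≡-sym E.corank2))
                     (+-monoʳ-≤ 2 (monotone λ x∈G → x∈p∩q⁺ (E.G⊆ x∈G , x∈p∩q⁺ (F.G⊆ x∈G , G.G⊆ x∈G))))))
        E.i∈ F.k∉ G.k∉ E.k∉ F.i∈ f∉G g∉E g∉F G.i∈
        }
      where
      module E = Separated ef
      module F = Separated (Separated-sym ef)
      g∉E : g ∉ value E.pencil
      g∉E g∈E = E.k∉ (eg⇒f E.pencil (E.G⊆ ∘ K⊆G) E.i∈ g∈E)
      g∉F : g ∉ value F.pencil
      g∉F g∈F = F.k∉ (fg⇒e F.pencil (F.G⊆ ∘ K⊆G) F.i∈ g∈F)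
      eg : Separated G e g
      eg = record
        { corank2  = E.corank2
        ; spanning = ≤-trans (≤-reflexive (≡-sym E.1+rGi≡R)) (∉⇒∉cl (flat E.pencil) ⊆-cl g∉E)
        }
      module G = Separated (Separated-sym eg)
      f∉G : f ∉ value G.pencil
      f∉G f∈G = G.k∉ (fg⇒e G.pencil (G.G⊆ ∘ K⊆G) f∈G G.i∈)

    module _ {C} (circuit : Circuit C) where

      open Circuit circuit

      ContainsRest : Fin n → Fin n → Hyperplane → Set
      ContainsRest i j H = ∀ {z} → z ∈ C → z ≢ i → z ≢ j → z ∈ value H

      -- Otherwise `i` would be the only element of `C` outside `H`.
      rest-parallel : ∀ {i j} → i ∈ C → ∀ H → ContainsRest i j H → i ∉ value H → j ∉ value H
      rest-parallel {i} {j} i∈C H rest i∉H j∈H = i∉H (dependent H i∈C contains)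
        where
        contains : ∀ {w} → w ∈ C → w ≢ i → w ∈ value H
        contains {w} w∈C w≢i with w ≟ᶠ j
        ... | yes ≡-refl = j∈H
        ... | no  w≢j    = rest w∈C w≢i w≢j

      ⊆-rest : ∀ {i j H} → ContainsRest i j H → (C - i - j) ⊆ value H
      ⊆-rest {i} {j} rest z∈ =
        rest (∈-remove⁻ (∈-remove⁻ z∈)) (∈-remove⇒≢ C (∈-remove⁻ z∈)) (∈-remove⇒≢ (C - i) z∈)

      rest-⊆ : ∀ {i j H} → (C - i - j) ⊆ value H → ContainsRest i j H
      rest-⊆ ⊆H z∈C z≢i z≢j = ⊆H (x∈p∧x≢y⇒x∈p-y (x∈p∧x≢y⇒x∈p-y z∈C z≢i) z≢j)

      -- `i` and `j` are parallel in the contraction of `C - i - j`.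
      q-rest : ∀ {i j} → i ∈ C → ∀ H H′ → ContainsRest i j H → ContainsRest i j H′ →
               i ∉ value H → i ∉ value H′ → q H i j ≈ q H′ i j
      q-rest {i} {j} i∈C H H′ rest rest′ =
        q-parallel (λ Q ⊆Q → rest-parallel i∈C Q (rest-⊆ {H = Q} ⊆Q)) H H′
                   (⊆-rest {H = H} rest) (⊆-rest {H = H′} rest′)

      -- The ratio of H at i and j is the one determined by C alone.
      Orthogonal : Hyperplane → Fin n → Fin n → Set ℓ
      Orthogonal H i j = ∀ H′ → ContainsRest i j H′ → i ∉ value H′ → q H i j ≈ q H′ i j

      orthogonal-sym : ∀ {H i j} → j ∈ C → Orthogonal H i j → Orthogonal H j i
      orthogonal-sym {H} {i} {j} j∈C orth H′ rest j∉H′ =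
        trans (q-sym H j i) (trans (⁻¹-cong (orth H′ rest′ (rest-parallel j∈C H′ rest j∉H′))) (sym (q-sym H′ j i)))
        where
        rest′ : ContainsRest i j H′
        rest′ z∈C z≢i z≢j = rest z∈C z≢j z≢i

      -- The elements `i`, `j`, `t` form a triangle in the contraction of the rest of `C`. Each of
      -- its three hyperplanes misses exactly two elements of `C`, so it computes a ratio determined
      -- by `C`, and the hexagon relation gives the third ratio from the other two.
      orthogonal-trans : ∀ {H i j t} → i ∈ C → j ∈ C → t ∈ C → i ≢ j → i ≢ t → j ≢ t →
                         Orthogonal H i t → Orthogonal H j t → Orthogonal H i j
      orthogonal-trans {H} {i} {j} {t} i∈C j∈C t∈C i≢j i≢t j≢t orth-it orth-jt H′ rest′ i∉H′ = trans
        (∙-cancelʳ (q H j t) _ _ (begin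
          q H i j ∙ q H j t    ≈⟨ q-trans H i j t ⟩
          q H i t              ≈⟨ orth-it Hf rest-it e∉Hf ⟩
          q Hf i t             ≈⟨ hexagon ⟨
          q Hg i j ∙ q He j t  ≈⟨ ∙-congˡ (orth-jt He rest-jt f∉He) ⟨
          q Hg i j ∙ q H j t   ∎))
        (q-rest i∈C Hg H′ rest-ij rest′ e∉Hg i∉H′)
        where
        open SetoidReasoning setoid
        K : Subset n
        K = C - i - j - t
        K⊆C : K ⊆ C
        K⊆C = ∈-remove⁻ ∘ ∈-remove⁻ ∘ ∈-remove⁻
        i∉K : i ∉ K
        i∉K = ∉-remove {A = C} ∘ ∈-remove⁻ ∘ ∈-remove⁻
        j∉K : j ∉ K
        j∉K = ∉-remove {A = C - i} ∘ ∈-remove⁻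
        t∉K : t ∉ K
        t∉K = ∉-remove {A = C - i - j}
        -- `perm` brings the inequalities back into the order `i`, `j`, `t`, so one argument serves
        -- all cases; `y` and `z` coincide when `Q` is only known to contain one of the three.
        fill : ∀ Q → K ⊆ value Q → ∀ {x y z w} → (w ≢ x → w ≢ y → w ≢ z → w ≢ i × w ≢ j × w ≢ t) →
               y ∈ value Q → z ∈ value Q → w ∈ C → w ≢ x → w ∈ value Q
        fill Q K⊆Q {x} {y} {z} {w} perm y∈Q z∈Q w∈C w≢x with w ≟ᶠ y | w ≟ᶠ z
        ... | yes w≡y | _       = subst (_∈ value Q) (≡-sym w≡y) y∈Q
        ... | no  _   | yes w≡z = subst (_∈ value Q) (≡-sym w≡z) z∈Q
        ... | no  w≢y | no  w≢z =
          let w≢i , w≢j , w≢t = perm w≢x w≢y w≢z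
          in K⊆Q (x∈p∧x≢y⇒x∈p-y (x∈p∧x≢y⇒x∈p-y (x∈p∧x≢y⇒x∈p-y w∈C w≢i) w≢j) w≢t)
        open Triangle (q-triangle {K} {i} {j} {t}
          (independent i∈C j∈C i≢j K⊆C i∉K j∉K)
          (independent j∈C t∈C j≢t (insert-⊆ K⊆C i∈C)
            (∉-insert j∉K (i≢j ∘ ≡-sym)) (∉-insert t∉K (i≢t ∘ ≡-sym)))
          (λ Q K⊆Q i∈Q j∈Q → dependent Q t∈C (fill Q K⊆Q (λ w≢t w≢i w≢j → w≢i , w≢j , w≢t) i∈Q j∈Q))
          (λ Q K⊆Q i∈Q t∈Q → dependent Q j∈C (fill Q K⊆Q (λ w≢j w≢i w≢t → w≢i , w≢j , w≢t) i∈Q t∈Q))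
          (λ Q K⊆Q j∈Q t∈Q → dependent Q i∈C (fill Q K⊆Q (λ w≢i w≢j w≢t → w≢i , w≢j , w≢t) j∈Q t∈Q)))
        rest-it : ContainsRest i t Hf
        rest-it w∈C w≢i w≢t = fill Hf K⊆Hf (λ _ w≢j _ → w≢i , w≢j , w≢t) f∈Hf f∈Hf w∈C w≢i
        rest-jt : ContainsRest j t He
        rest-jt w∈C w≢j w≢t = fill He K⊆He (λ _ w≢i _ → w≢i , w≢j , w≢t) e∈He e∈He w∈C w≢j
        rest-ij : ContainsRest i j Hg
        rest-ij w∈C w≢i w≢j = fill Hg K⊆Hg (λ _ w≢t _ → w≢i , w≢j , w≢t) g∈Hg g∈Hg w∈C w≢i

      -- The induction measure is the corank of `C ∩ H`. If a third element `t` of `C` lies outside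
      -- `H`, applying `two-of-three` to `i , j , t` and then to `j , i , t` gives the claim for `i`
      -- and `j`, or for both of them with `t`.
      q-orthogonal : ∀ H {i j} → i ∈ C → j ∈ C → i ∉ value H → j ∉ value H → i ≢ j → Orthogonal H i j
      q-orthogonal H = go R H (m≤m+n R _)
        where
        go : ∀ k H → R ≤ k + r (C ∩ value H) → ∀ {i j} →
             i ∈ C → j ∈ C → i ∉ value H → j ∉ value H → i ≢ j → Orthogonal H i j
        go zero H R≤ = contradiction (≤-trans R≤ (monotone (p∩q⊆q C (value H)))) (<⇒≱ (≤-reflexive (r-hyperplane H)))
        go (suc k) H R≤ {i} {j} i∈C j∈C i∉H j∉H i≢j with ∃-or-⊆ (C - i - j) (value H)
        ... | inj₂ rest = λ H′ rest′ i∉H′ → q-rest i∈C H H′ (rest-⊆ {H = H} rest) rest′ i∉H i∉H′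
        ... | inj₁ (t , t∈ , t∉H) =
          [ id
          , (λ orth-jt → [ orthogonal-sym {H} i∈C
                         , (λ orth-it → orthogonal-trans {H} i∈C j∈C t∈C i≢j i≢t j≢t orth-it orth-jt) ]′
              (two-of-three j∈C i∈C t∈C j∉H i∉H t∉H (i≢j ∘ ≡-sym) j≢t i≢t))
          ]′ (two-of-three i∈C j∈C t∈C i∉H j∉H t∉H i≢j i≢t j≢t)
          where
          t∈C : t ∈ C
          t∈C = ∈-remove⁻ (∈-remove⁻ t∈)
          i≢t : i ≢ t
          i≢t = ∈-remove⇒≢ C (∈-remove⁻ t∈) ∘ ≡-sym
          j≢t : j ≢ t
          j≢t = ∈-remove⇒≢ (C - i) t∈ ∘ ≡-sym

          -- `P` contains `C ∩ H` and in addition `p`, so the induction applies to it; adjacency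
          -- carries the ratio back to `H`.
          advance : ∀ {G} P → 2 + r G ≡ R → G ⊆ value P → G ⊆ value H → C ∩ value H ⊆ G →
                    ∀ {p i j} → p ∈ C → p ∈ value P → p ∉ value H →
                    i ∈ C → j ∈ C → i ∉ value H → j ∉ value H → i ∉ value P → j ∉ value P → i ≢ j →
                    Orthogonal H i j
          advance {G} P corank2 G⊆P G⊆H C∩H⊆G {p} {i} {j} p∈C p∈P p∉H i∈C j∈C i∉H j∉H i∉P j∉P i≢j H′ rest′ i∉H′ =
            trans (sym (q-adjacent P H (adjacent corank2 {P} {H} G⊆P G⊆H p∈P p∉H) i∉P j∉P i∉H j∉H))
                  (go k P closer i∈C j∈C i∉P j∉P i≢j H′ rest′ i∉H′)
            where
            open ≤-Reasoning
            closer : R ≤ k + r (C ∩ value P)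
            closer = begin
              R                                  ≤⟨ R≤ ⟩
              suc k + r (C ∩ value H)            ≡⟨ +-suc k _ ⟨
              k + suc (r (C ∩ value H))          ≤⟨ +-monoʳ-≤ k (∉⇒∉cl (flat H) (p∩q⊆q C (value H)) p∉H) ⟩
              k + r ((C ∩ value H) ∪ ⁅ p ⁆)      ≤⟨ +-monoʳ-≤ k (monotone (insert-⊆
                                                      (λ e∈ → x∈p∩q⁺ (p∩q⊆p C (value H) e∈ , G⊆P (C∩H⊆G e∈)))
                                                      (x∈p∩q⁺ (p∈C , p∈P)))) ⟩
              k + r (C ∩ value P)                ∎

          -- Some corank 2 flat below H separates i from t; whichever of the
          -- two hyperplanes through it avoids j settles one of the two pairs.
          two-of-three : ∀ {i j t} → i ∈ C → j ∈ C → t ∈ C → i ∉ value H → j ∉ value H → t ∉ value H →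
                         i ≢ j → i ≢ t → j ≢ t → Orthogonal H i j ⊎ Orthogonal H j t
          two-of-three {i} {j} {t} i∈C j∈C t∈C i∉H j∉H t∉H i≢j i≢t j≢t
            with separate {T = value H} {i} {t} (p∩q⊆q C (value H))
                   (∉⇒∉cl (flat H) (p∩q⊆q C (value H)) i∉H)
                   (independent t∈C j∈C (j≢t ∘ ≡-sym) (insert-⊆ (p∩q⊆p C (value H)) i∈C)
                     (∉-insert (t∉H ∘ p∩q⊆q C (value H)) (i≢t ∘ ≡-sym))
                     (∉-insert (j∉H ∘ p∩q⊆q C (value H)) (i≢j ∘ ≡-sym)))
                   (r-hyperplane-insert H ∈-∪ˡ ∈-insert i∉H)
          ... | G , X⊆G , G⊆H , sep with j ∈? value (Separated.pencil (Separated-sym sep))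
          ... | no j∉T = inj₁ (advance T.pencil T.corank2 T.G⊆ G⊆H X⊆G t∈C T.i∈ t∉H i∈C j∈C i∉H j∉H T.k∉ j∉T i≢j)
            where module T = Separated (Separated-sym sep)
          -- Distinct members of the pencil share only elements in the closure of `G`. As `j` is
          -- outside `H`, it is not one of these, so `I.pencil` avoids it.
          ... | yes j∈T = inj₂ (advance I.pencil I.corank2 I.G⊆ G⊆H X⊆G i∈C I.i∈ i∉H j∈C t∈C j∉H t∉H
                  (pencil-disjoint I.corank2 {T.pencil} {I.pencil} T.G⊆ I.G⊆ T.i∈ I.k∉ j∈T
                    (∉⇒∉cl (flat H) G⊆H j∉H)) I.k∉ j≢t)
            where
            module I = Separated sep
            module T = Separated (Separated-sym sep)

    -- A circuit through `x` and `y` with all other elements in `H′` determines the ratio at `H`,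
    -- and `H′` itself computes it.
    q-independent : ∀ H H′ {x y} → x ∉ value H → y ∉ value H → x ∉ value H′ → y ∉ value H′ →
                    q H x y ≈ q H′ x y
    q-independent H H′ {x} {y} x∉H y∉H x∉H′ y∉H′ with x ≟ᶠ y
    ... | yes ≡-refl = trans (q-refl H x) (sym (q-refl H′ x))
    ... | no  x≢y    =
      let C , circuit , x∈C , y∈C , rest = fundamental-circuit H′ x∉H′ y∉H′ x≢y
      in q-orthogonal circuit H x∈C y∈C x∉H y∉H x≢y H′ rest x∉H′

    -- A connected minor on three elements is U₁,₃ or U₂,₃, so e, f and g lie
    -- in a common cocircuit or form a triangle in a contraction.
    q-concat-connected : ∀ H₁ H₂ {K e f g} → Connected K ((⁅ e ⁆ ∪ ⁅ f ⁆) ∪ ⁅ g ⁆) →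
      e ∉ value H₁ → f ∉ value H₁ → f ∉ value H₂ → g ∉ value H₂ →
      ∃[ H₃ ] e ∉ value H₃ × g ∉ value H₃ × q H₁ e f ∙ q H₂ f g ≈ q H₃ e g
    q-concat-connected H₁ H₂ {K} {e} {f} {g} conn e∉H₁ f∉H₁ f∉H₂ g∉H₂ =
      [ common-hyperplane , triangle ]′ (≤-<-connex (r ((⁅ e ⁆ ∪ ⁅ f ⁆) ∪ K)) (suc (r K)))
      where
      open ≤-Reasoning
      T : Subset n
      T = (⁅ e ⁆ ∪ ⁅ f ⁆) ∪ ⁅ g ⁆
      k a : ℕ
      k = r K
      a = r (T ∪ K)
      e∈T : e ∈ T
      e∈T = ∈-∪ˡ (∈-∪ˡ (x∈⁅x⁆ e))
      f∈T : f ∈ T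
      f∈T = ∈-∪ˡ ∈-insert
      g∈T : g ∈ T
      g∈T = ∈-insert
      insert-K : ∀ x → r (⁅ x ⁆ ∪ K) ≤ 1 + k
      insert-K x = ≤-trans (monotone (∪-least ∈-∪ʳ ∈-∪ˡ)) (r-insert x)

      -- `x`, `y`, `z` are `e`, `f`, `g` in some order. They may coincide, which is harmless as the
      -- parts of a separation may overlap.
      part : ∀ {x y z} → x ∈ T → y ∈ T → z ∈ T → T ⊆ ⁅ x ⁆ ∪ ⁅ y ⁆ ∪ ⁅ z ⁆ →
             a + k < r (⁅ x ⁆ ∪ K) + r ((⁅ y ⁆ ∪ ⁅ z ⁆) ∪ K)
      part {x} {y} {z} x∈T y∈T z∈T cover = connected-< conn ⁅ x ⁆ (⁅ y ⁆ ∪ ⁅ z ⁆)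
        (⁅⁆-⊆ x∈T) (∪-least (⁅⁆-⊆ y∈T) (⁅⁆-⊆ z∈T)) cover (x , x∈⁅x⁆ x) (y , ∈-∪ˡ (x∈⁅x⁆ y))

      -- `x` has rank at most one over `K`, so the strict inequality of `part` leaves no rank for it
      -- to add to the other two.
      pair-spans : ∀ {x y z} → x ∈ T → y ∈ T → z ∈ T → T ⊆ ⁅ x ⁆ ∪ ⁅ y ⁆ ∪ ⁅ z ⁆ →
                   a ≤ r ((⁅ y ⁆ ∪ ⁅ z ⁆) ∪ K)
      pair-spans {x} {y} {z} x∈T y∈T z∈T cover = +-cancelˡ-≤ (suc k) _ _ (begin
        suc k + a                                    ≡⟨ cong suc (+-comm k a) ⟩
        suc (a + k)                                  ≤⟨ part x∈T y∈T z∈T cover ⟩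
        r (⁅ x ⁆ ∪ K) + r ((⁅ y ⁆ ∪ ⁅ z ⁆) ∪ K)      ≤⟨ +-monoˡ-≤ _ (insert-K x) ⟩
        suc k + r ((⁅ y ⁆ ∪ ⁅ z ⁆) ∪ K)              ∎)

      nonloop : ∀ {x y z} → x ∈ T → y ∈ T → z ∈ T → T ⊆ ⁅ x ⁆ ∪ ⁅ y ⁆ ∪ ⁅ z ⁆ → x ∉cl K
      nonloop {x} {y} {z} x∈T y∈T z∈T cover = +-cancelˡ-< a _ _ (begin-strict
        a + k                                        <⟨ part x∈T y∈T z∈T cover ⟩
        r (⁅ x ⁆ ∪ K) + r ((⁅ y ⁆ ∪ ⁅ z ⁆) ∪ K)      ≤⟨ +-mono-≤ (monotone (∪-least ∈-∪ʳ ∈-∪ˡ))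
                                                          (monotone (∪-mono (∪-least (⁅⁆-⊆ y∈T) (⁅⁆-⊆ z∈T)) id)) ⟩
        r (K ∪ ⁅ x ⁆) + a                            ≡⟨ +-comm _ a ⟩
        a + r (K ∪ ⁅ x ⁆)                            ∎)

      spans : ∀ {x y z} → x ∈ T → y ∈ T → z ∈ T → T ⊆ ⁅ x ⁆ ∪ ⁅ y ⁆ ∪ ⁅ z ⁆ →
              ∀ H → K ⊆ value H → y ∈ value H → z ∈ value H → x ∈ value H
      spans {x} {y} {z} x∈T y∈T z∈T cover H K⊆H y∈H z∈H = decidable-stable (x ∈? value H) λ x∉H →
        <-irrefl ≡-refl (begin-strict
          r ((⁅ y ⁆ ∪ ⁅ z ⁆) ∪ K)              <⟨ ∉⇒∉cl (flat H) (∪-least (∪-least (⁅⁆-⊆ y∈H) (⁅⁆-⊆ z∈H)) K⊆H) x∉H ⟩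
          r (((⁅ y ⁆ ∪ ⁅ z ⁆) ∪ K) ∪ ⁅ x ⁆)    ≤⟨ monotone (insert-⊆ (∪-mono (∪-least (⁅⁆-⊆ y∈T) (⁅⁆-⊆ z∈T)) id) (∈-∪ˡ x∈T)) ⟩
          a                                    ≤⟨ pair-spans x∈T y∈T z∈T cover ⟩
          r ((⁅ y ⁆ ∪ ⁅ z ⁆) ∪ K)              ∎)

      cover-e : T ⊆ ⁅ e ⁆ ∪ ⁅ f ⁆ ∪ ⁅ g ⁆
      cover-e = ∪-least (∪-mono id ∈-∪ˡ) (∈-∪ʳ ∘ ∈-∪ʳ)
      cover-f : T ⊆ ⁅ f ⁆ ∪ ⁅ e ⁆ ∪ ⁅ g ⁆
      cover-f = ∪-least (∪-least (∈-∪ʳ ∘ ∈-∪ˡ) ∈-∪ˡ) (∈-∪ʳ ∘ ∈-∪ʳ)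
      cover-g : T ⊆ ⁅ g ⁆ ∪ ⁅ e ⁆ ∪ ⁅ f ⁆
      cover-g = ∪-least ∈-∪ʳ ∈-∪ˡ

      e∉cl : e ∉cl K
      e∉cl = nonloop e∈T f∈T g∈T cover-e

      Goal : Set ℓ
      Goal = ∃[ H₃ ] e ∉ value H₃ × g ∉ value H₃ × q H₁ e f ∙ q H₂ f g ≈ q H₃ e g

      triangle : suc (r K) < r ((⁅ e ⁆ ∪ ⁅ f ⁆) ∪ K) → Goal
      triangle rank2 = Hf , e∉Hf , g∉Hf ,
        trans (∙-cong (q-independent H₁ Hg e∉H₁ f∉H₁ e∉Hg f∉Hg) (q-independent H₂ He f∉H₂ g∉H₂ f∉He g∉He)) hexagon
        where
        open Triangle (q-triangle e∉cl
          (≤-trans (s≤s (r-insert e)) (≤-trans rank2 (monotone (∪-least (∪-mono ∈-∪ʳ id) (∈-∪ˡ ∘ ∈-∪ˡ)))))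
          (spans g∈T e∈T f∈T cover-g)
          (spans f∈T e∈T g∈T cover-f)
          (spans e∈T f∈T g∈T cover-e))

      common-hyperplane : r ((⁅ e ⁆ ∪ ⁅ f ⁆) ∪ K) ≤ suc (r K) → Goal
      -- `G` spans a hyperplane through `K` avoiding `e`. Over `K` the three elements are parallel,
      -- so it avoids all of them.
      common-hyperplane rank1 with grow K full ⁅ e ⁆ 1 ⊆⊤ e∉cl (monotone ∈-∪ˡ)
      ... | G , K⊆G , _ , 1+rG≤R , R≤rGe =
        H , e∉H , g∉H , trans
          (∙-cong (q-independent H₁ H e∉H₁ f∉H₁ e∉H f∉H) (q-independent H₂ H f∉H₂ g∉H₂ f∉H g∉H))
          (q-trans H e f g)
        where
        1+rG≡R : 1 + r G ≡ R
        1+rG≡R = ≤-antisym 1+rG≤R (≤-trans R≤rGe (r-insert e))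
        H : Hyperplane
        H = hyperplane G 1+rG≡R
        e∉H : e ∉ value H
        e∉H = ∉-hyperplane (≤-trans 1+rG≤R R≤rGe)
        avoids : ∀ {x} → x ∈ T → x ∉cl K → x ∉ value H
        avoids {x} x∈T x∉cl x∈H = <-irrefl ≡-refl (begin-strict
          r (K ∪ ⁅ x ⁆)              <⟨ ∉⇒∉cl (flat H) (insert-⊆ (⊆-cl ∘ K⊆G) x∈H) e∉H ⟩
          r ((K ∪ ⁅ x ⁆) ∪ ⁅ e ⁆)    ≤⟨ monotone (insert-⊆ (∪-least ∈-∪ʳ (⁅⁆-⊆ (∈-∪ˡ x∈T))) (∈-∪ˡ e∈T)) ⟩
          a                          ≤⟨ pair-spans g∈T e∈T f∈T cover-g ⟩
          r ((⁅ e ⁆ ∪ ⁅ f ⁆) ∪ K)    ≤⟨ rank1 ⟩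
          1 + k                      ≤⟨ x∉cl ⟩
          r (K ∪ ⁅ x ⁆)              ∎)
        f∉H : f ∉ value H
        f∉H = avoids f∈T (nonloop f∈T e∈T g∈T cover-f)
        g∉H : g ∉ value H
        g∉H = avoids g∈T (nonloop g∈T e∈T f∈T cover-g)

    -- The two cocircuits share `f`, so their union is connected after contracting `H₁ ∩ H₂` and has
    -- a connected minor on `e`, `f` and `g`.
    q-concat : ∀ H₁ H₂ {e f g} → e ∉ value H₁ → f ∉ value H₁ → f ∉ value H₂ → g ∉ value H₂ →
               ∃[ H₃ ] e ∉ value H₃ × g ∉ value H₃ × q H₁ e f ∙ q H₂ f g ≈ q H₃ e g
    q-concat H₁ H₂ e∉H₁ f∉H₁ f∉H₂ g∉H₂ =
      q-concat-connected H₁ H₂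
        (proj₂ (connected-minor
          (insert-⊆ (insert-⊆ (⁅⁆-⊆ (outside₁ e∉H₁)) (outside₁ f∉H₁)) (outside₂ g∉H₂))
          (cocircuits-connected H₁ H₂ f∉H₁ f∉H₂)))
        e∉H₁ f∉H₁ f∉H₂ g∉H₂
      where
      outside₁ : ∀ {x} → x ∉ value H₁ → x ∈ ∁ (value H₁ ∩ value H₂)
      outside₁ x∉H₁ = x∉p⇒x∈∁p (x∉H₁ ∘ p∩q⊆p (value H₁) (value H₂))
      outside₂ : ∀ {x} → x ∉ value H₂ → x ∈ ∁ (value H₁ ∩ value H₂)
      outside₂ x∉H₂ = x∉p⇒x∈∁p (x∉H₂ ∘ p∩q⊆q (value H₁) (value H₂))

    flat? : Decidable IsFlat
    flat? A = map′ (λ f {e} → f e) (λ f e → f {e}) (all? λ e → ¬? (e ∈? A) →-dec (_ <? _))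

    -- The potential is extended one element at a time. The value at `x` is read off from one
    -- hyperplane avoiding `x` and some earlier `f₀`, and `q-concat` makes it consistent with all
    -- other hyperplanes.
    q-potential : ∃[ t ] ∀ H {e f} → e ∉ value H → f ∉ value H → q H e f ≈ t e ∙ t f ⁻¹
    q-potential =
      let t , potential = subset-induction Potential
            ((λ _ → ε) , λ H e∈∅ → contradiction e∈∅ ∉⊥) full λ {A} x _ → extend A x
      in t , λ H → potential H ∈⊤ ∈⊤
      where
      Potential : Subset n → Set _
      Potential A = ∃[ t ] ∀ H {e f} → e ∈ A → f ∈ A → e ∉ value H → f ∉ value H → q H e f ≈ t e ∙ t f ⁻¹

      extend : ∀ A x → Potential A → Potential (A ∪ ⁅ x ⁆)
      extend A x (t , potential) with x ∈? A
      ... | yes x∈A = t , λ H e∈ f∈ → potential H (insert-⊆ id x∈A e∈) (insert-⊆ id x∈A f∈)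
      ... | no  x∉A = extended
            (anySubset? λ X → (flat? X ×-dec (1 + r X ≟ R)) ×-dec ¬? (x ∈? X) ×-dec
              any? λ f → (f ∈? A) ×-dec ¬? (f ∈? X))
        where
        open SetoidReasoning setoid
        extended : Dec (∃[ X ] IsFlatOfCorank 1 X × x ∉ X × ∃[ f ] f ∈ A × f ∉ X) → Potential (A ∪ ⁅ x ⁆)
        extended (yes (X , isHyperplane , x∉X , f₀ , f₀∈A , f₀∉X)) = t′ , potential′
          where
          H₀ : Hyperplane
          H₀ = X , [ isHyperplane ]
          t′ : Fin n → Carrier
          t′ = updateAt t x (const (q H₀ x f₀ ∙ t f₀))
          t′-x : t′ x ≈ q H₀ x f₀ ∙ t f₀
          t′-x = reflexive (updateAt-updates x t)
          t′-A : ∀ {e} → e ∈ A → t′ e ≈ t e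
          t′-A {e} e∈A = reflexive (updateAt-minimal e x t (∈-∉⇒≢ e∈A x∉A))
          new : ∀ H {f} → f ∈ A → x ∉ value H → f ∉ value H → q H x f ≈ t′ x ∙ t′ f ⁻¹
          new H {f} f∈A x∉H f∉H =
            let H₃ , f₀∉H₃ , f∉H₃ , concat = q-concat H₀ H f₀∉X x∉X x∉H f∉H in begin
            q H x f                                   ≈⟨ identityˡ _ ⟨
            ε ∙ q H x f                               ≈⟨ ∙-congʳ (trans (q-trans H₀ x f₀ x) (q-refl H₀ x)) ⟨
            (q H₀ x f₀ ∙ q H₀ f₀ x) ∙ q H x f         ≈⟨ assoc _ _ _ ⟩
            q H₀ x f₀ ∙ (q H₀ f₀ x ∙ q H x f)         ≈⟨ ∙-congˡ (trans concat (potential H₃ f₀∈A f∈A f₀∉H₃ f∉H₃)) ⟩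
            q H₀ x f₀ ∙ (t f₀ ∙ t f ⁻¹)               ≈⟨ assoc _ _ _ ⟨
            (q H₀ x f₀ ∙ t f₀) ∙ t f ⁻¹               ≈⟨ ∙-cong t′-x (⁻¹-cong (t′-A f∈A)) ⟨
            t′ x ∙ t′ f ⁻¹                            ∎
          flip : ∀ H e f → q H e f ≈ t′ e ∙ t′ f ⁻¹ → q H f e ≈ t′ f ∙ t′ e ⁻¹
          flip H e f qef = begin
            q H f e                  ≈⟨ q-sym H f e ⟩
            q H e f ⁻¹               ≈⟨ ⁻¹-cong qef ⟩
            (t′ e ∙ t′ f ⁻¹) ⁻¹      ≈⟨ ⁻¹-anti-homo-// (t′ e) (t′ f) ⟩
            t′ f ∙ t′ e ⁻¹           ∎
          potential′ : ∀ H {e f} → e ∈ A ∪ ⁅ x ⁆ → f ∈ A ∪ ⁅ x ⁆ → e ∉ value H → f ∉ value H → q H e f ≈ t′ e ∙ t′ f ⁻¹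
          potential′ H {e} {f} e∈ f∈ e∉H f∉H with x∈p∪q⁻ A ⁅ x ⁆ e∈ | x∈p∪q⁻ A ⁅ x ⁆ f∈
          ... | inj₁ e∈A | inj₁ f∈A = trans (potential H e∈A f∈A e∉H f∉H) (sym (∙-cong (t′-A e∈A) (⁻¹-cong (t′-A f∈A))))
          ... | inj₂ e∈x | inj₁ f∈A with ≡-refl ← x∈⁅y⁆⇒x≡y x e∈x = new H f∈A e∉H f∉H
          ... | inj₁ e∈A | inj₂ f∈x with ≡-refl ← x∈⁅y⁆⇒x≡y x f∈x = flip H f e (new H e∈A f∉H e∉H)
          ... | inj₂ e∈x | inj₂ f∈x with ≡-refl ← x∈⁅y⁆⇒x≡y x e∈x | ≡-refl ← x∈⁅y⁆⇒x≡y x f∈x =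
            trans (q-refl H e) (sym (inverseʳ (t′ e)))
        -- No hyperplane avoids both `x` and an element of `A`, so any value at `x` will do.
        extended (no none) = t , potential′
          where
          potential′ : ∀ H {e f} → e ∈ A ∪ ⁅ x ⁆ → f ∈ A ∪ ⁅ x ⁆ → e ∉ value H → f ∉ value H → q H e f ≈ t e ∙ t f ⁻¹
          potential′ H {e} {f} e∈ f∈ e∉H f∉H with x∈p∪q⁻ A ⁅ x ⁆ e∈ | x∈p∪q⁻ A ⁅ x ⁆ f∈
          ... | inj₁ e∈A | inj₁ f∈A = potential H e∈A f∈A e∉H f∉H
          ... | inj₂ e∈x | inj₁ f∈A with ≡-refl ← x∈⁅y⁆⇒x≡y x e∈x =
            contradiction (value H , (flat H , r-hyperplane H) , e∉H , f , f∈A , f∉H) none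
          ... | inj₁ e∈A | inj₂ f∈x with ≡-refl ← x∈⁅y⁆⇒x≡y x f∈x =
            contradiction (value H , (flat H , r-hyperplane H) , f∉H , e , e∈A , e∉H) none
          ... | inj₂ e∈x | inj₂ f∈x with ≡-refl ← x∈⁅y⁆⇒x≡y x e∈x | ≡-refl ← x∈⁅y⁆⇒x≡y x f∈x =
            trans (q-refl H e) (sym (inverseʳ (t e)))

-- Fractions and quotients in abelian groups.

module Fractions (𝔾 : AbelianGroup ℓ₁ ℓ) where

  open AbelianGroup 𝔾
  open AbelianGroupProperties 𝔾
  open CommutativeSemigroupProperties commutativeSemigroup using (interchange)
  open SetoidReasoning setoid

  fraction-trans : ∀ x y z → (x ∙ y ⁻¹) ∙ (y ∙ z ⁻¹) ≈ x ∙ z ⁻¹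
  fraction-trans x y z = begin
    (x ∙ y ⁻¹) ∙ (y ∙ z ⁻¹)  ≈⟨ assoc _ _ _ ⟨
    ((x ∙ y ⁻¹) ∙ y) ∙ z ⁻¹  ≈⟨ ∙-congʳ (//-rightDividesˡ y x) ⟩
    x ∙ z ⁻¹                 ∎

  cancel-numerator : ∀ a x y → (a ∙ x) ∙ (a ∙ y) ⁻¹ ≈ x ∙ y ⁻¹
  cancel-numerator a x y = begin
    (a ∙ x) ∙ (a ∙ y) ⁻¹      ≈⟨ ∙-congˡ (⁻¹-∙-comm a y) ⟨
    (a ∙ x) ∙ (a ⁻¹ ∙ y ⁻¹)   ≈⟨ interchange _ _ _ _ ⟩
    (a ∙ a ⁻¹) ∙ (x ∙ y ⁻¹)   ≈⟨ ∙-congʳ (inverseʳ a) ⟩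
    ε ∙ (x ∙ y ⁻¹)            ≈⟨ identityˡ _ ⟩
    x ∙ y ⁻¹                  ∎

  fractions-≈ : ∀ {x x′ y y′} → x ∙ y′ ≈ y ∙ x′ → x ∙ x′ ⁻¹ ≈ y ∙ y′ ⁻¹
  fractions-≈ {x} {x′} {y} {y′} xy′≈yx′ = begin
    x ∙ x′ ⁻¹                ≈⟨ cancel-numerator y′ x x′ ⟨
    (y′ ∙ x) ∙ (y′ ∙ x′) ⁻¹  ≈⟨ ∙-cong (trans (comm y′ x) (trans xy′≈yx′ (comm y x′))) (⁻¹-cong (comm y′ x′)) ⟩
    (x′ ∙ y) ∙ (x′ ∙ y′) ⁻¹  ≈⟨ cancel-numerator x′ y y′ ⟩
    y ∙ y′ ⁻¹                ∎

  cross-multiply : ∀ {a b x x′ y y′} → b ∙ y ≈ a ∙ x → b ∙ y′ ≈ a ∙ x′ → x ∙ y′ ≈ y ∙ x′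
  cross-multiply {a} {b} {x} {x′} {y} {y′} by≈ax by′≈ax′ = ∙-cancelˡ (a ∙ b) _ _ (begin
    (a ∙ b) ∙ (x ∙ y′)  ≈⟨ interchange _ _ _ _ ⟩
    (a ∙ x) ∙ (b ∙ y′)  ≈⟨ ∙-cong (sym by≈ax) by′≈ax′ ⟩
    (b ∙ y) ∙ (a ∙ x′)  ≈⟨ interchange _ _ _ _ ⟩
    (b ∙ a) ∙ (y ∙ x′)  ≈⟨ ∙-congʳ (comm b a) ⟩
    (a ∙ b) ∙ (y ∙ x′)  ∎)

  -- The quotient of `x` by `y` is the same at `e` and `a`, at `a` and `b`, and at `b` and `f`.
  transfer : ∀ {xₑ yₑ xf yf xₐ yₐ xb yb} → xₑ ∙ yₐ ≈ yₑ ∙ xₐ → xf ∙ yb ≈ yf ∙ xb →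
             xₐ ∙ yb ≈ xb ∙ yₐ → xₑ ∙ yf ≈ yₑ ∙ xf
  transfer {xₑ} {yₑ} {xf} {yf} {xₐ} {yₐ} {xb} {yb} ea fb ab = ∙-cancelʳ (yₐ ∙ xb) _ _ (begin
    (xₑ ∙ yf) ∙ (yₐ ∙ xb)  ≈⟨ interchange _ _ _ _ ⟩
    (xₑ ∙ yₐ) ∙ (yf ∙ xb)  ≈⟨ ∙-cong ea (sym fb) ⟩
    (yₑ ∙ xₐ) ∙ (xf ∙ yb)  ≈⟨ interchange _ _ _ _ ⟩
    (yₑ ∙ xf) ∙ (xₐ ∙ yb)  ≈⟨ ∙-congˡ (trans ab (comm xb yₐ)) ⟩
    (yₑ ∙ xf) ∙ (yₐ ∙ xb)  ∎)

  -- `x₃₁` stands for the value of the third hyperplane function at the first element, and so on.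
  -- After expanding the fractions by `a`, `b` and `c`, the product telescopes.
  hexagon : ∀ {a b c x₁₂ x₁₃ x₂₁ x₂₃ x₃₁ x₃₂} →
            c ∙ x₃₁ ≈ b ∙ x₂₁ → c ∙ x₃₂ ≈ a ∙ x₁₂ → b ∙ x₂₃ ≈ a ∙ x₁₃ →
            (x₃₁ ∙ x₃₂ ⁻¹) ∙ (x₁₂ ∙ x₁₃ ⁻¹) ≈ x₂₁ ∙ x₂₃ ⁻¹
  hexagon {a} {b} {c} {x₁₂} {x₁₃} {x₂₁} {x₂₃} {x₃₁} {x₃₂} r₁ r₂ r₃ = begin
    (x₃₁ ∙ x₃₂ ⁻¹) ∙ (x₁₂ ∙ x₁₃ ⁻¹)
      ≈⟨ ∙-cong (cancel-numerator c x₃₁ x₃₂) (cancel-numerator a x₁₂ x₁₃) ⟨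
    ((c ∙ x₃₁) ∙ (c ∙ x₃₂) ⁻¹) ∙ ((a ∙ x₁₂) ∙ (a ∙ x₁₃) ⁻¹)
      ≈⟨ ∙-cong (∙-cong r₁ (⁻¹-cong r₂)) (∙-congˡ (⁻¹-cong (sym r₃))) ⟩
    ((b ∙ x₂₁) ∙ (a ∙ x₁₂) ⁻¹) ∙ ((a ∙ x₁₂) ∙ (b ∙ x₂₃) ⁻¹)
      ≈⟨ fraction-trans _ _ _ ⟩
    (b ∙ x₂₁) ∙ (b ∙ x₂₃) ⁻¹
      ≈⟨ cancel-numerator b x₂₁ x₂₃ ⟩
    x₂₁ ∙ x₂₃ ⁻¹ ∎

module _ (𝔾 : AbelianGroup ℓ₁ ℓ) (S : Pred (AbelianGroup.Carrier 𝔾) ℓ₂) where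

  open AbelianGroup 𝔾
  open AbelianGroupProperties 𝔾
  open CommutativeSemigroupProperties commutativeSemigroup using (interchange)
  open Fractions 𝔾 using (fraction-trans)
  open SetoidReasoning setoid

  -- A record rather than a synonym, so that x and y can be inferred.
  record _≋_ (x y : Carrier) : Set (ℓ₁ ⊔ ℓ ⊔ ℓ₂) where
    constructor modulo
    field quotient∈span : Span group S (x ∙ y ⁻¹)

  ≈⇒≋ : ∀ {x y} → x ≈ y → x ≋ y
  ≈⇒≋ {x} {y} x≈y = modulo (resp (sym (trans (∙-congʳ x≈y) (inverseʳ y))) unit)

  quotient : AbelianGroup ℓ₁ (ℓ₁ ⊔ ℓ ⊔ ℓ₂)
  quotient = record
    { Carrier        = Carrier
    ; _≈_            = _≋_
    ; _∙_            = _∙_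
    ; ε              = ε
    ; _⁻¹            = _⁻¹
    ; isAbelianGroup = record
      { isGroup = record
        { isMonoid = record
          { isSemigroup = record
            { isMagma = record
              { isEquivalence = record
                { refl  = ≈⇒≋ refl
                ; sym   = λ { {x} {y} (modulo xy⁻¹) → modulo (resp (⁻¹-anti-homo-// x y) (inv xy⁻¹)) }
                ; trans = λ { {x} {y} {z} (modulo xy⁻¹) (modulo yz⁻¹) → modulo (resp (fraction-trans x y z) (mul xy⁻¹ yz⁻¹)) }
                }
              ; ∙-cong = λ { {x} {y} {u} {v} (modulo xy⁻¹) (modulo uv⁻¹) → modulo (resp (begin
                  (x ∙ y ⁻¹) ∙ (u ∙ v ⁻¹)  ≈⟨ interchange _ _ _ _ ⟩
                  (x ∙ u) ∙ (y ⁻¹ ∙ v ⁻¹)  ≈⟨ ∙-congˡ (⁻¹-∙-comm y v) ⟩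
                  (x ∙ u) ∙ (y ∙ v) ⁻¹     ∎) (mul xy⁻¹ uv⁻¹)) }
              }
            ; assoc = λ x y z → ≈⇒≋ (assoc x y z)
            }
          ; identity = (λ x → ≈⇒≋ (identityˡ x)) , (λ x → ≈⇒≋ (identityʳ x))
          }
        ; inverse = (λ x → ≈⇒≋ (inverseˡ x)) , (λ x → ≈⇒≋ (inverseʳ x))
        ; ⁻¹-cong = λ { {x} {y} (modulo xy⁻¹) → modulo (resp (sym (⁻¹-∙-comm x (y ⁻¹))) (inv xy⁻¹)) }
        }
      ; comm = λ x y → ≈⇒≋ (comm x y)
      }
    }

-- Rescaling when all cross-ratios are trivial.

-- A family φ H e with values in an abelian group, subject to the relations
-- which hold in the unit group of a pasture modulo -1 and all cross-ratios;
-- φ H e is a junk value for e ∈ H.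
module TrivialCrossRatios
  (M : Matroid n) (𝔾 : AbelianGroup ℓ₁ ℓ) (choice : ∀ θ → Choice M θ)
  (φ : Matroid.Hyperplane M → Fin n → AbelianGroup.Carrier 𝔾)
  where

  open Matroid M renaming (rank to r)
  open MatroidProperties M
  open AbelianGroup 𝔾 hiding (_-_)
  open Fractions 𝔾

  -- At an element of exactly one of the hyperplanes, one term of a three-term relation vanishes and
  -- the other two agree up to -1, which is trivial here.
  record ThreeTerm (H₁ H₂ H₃ : Hyperplane) : Set (ℓ₁ ⊔ ℓ) where
    field
      a b c  : Carrier
      ratio₁ : ∀ {e} → e ∈ value H₁ → e ∉ value H₂ → e ∉ value H₃ → c ∙ φ H₃ e ≈ b ∙ φ H₂ e
      ratio₂ : ∀ {e} → e ∉ value H₁ → e ∈ value H₂ → e ∉ value H₃ → c ∙ φ H₃ e ≈ a ∙ φ H₁ e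
      ratio₃ : ∀ {e} → e ∉ value H₁ → e ∉ value H₂ → e ∈ value H₃ → b ∙ φ H₂ e ≈ a ∙ φ H₁ e

  TrivialCrossRatio : Θ M → Set ℓ
  TrivialCrossRatio θ = φ H₁ a ∙ φ H₂ b ≈ φ H₁ b ∙ φ H₂ a
    where
    open Θ θ
    open Choice (choice θ)

  module _
    (three-term : ∀ H₁ H₂ H₃ → H₁ ≢ H₂ → H₁ ≢ H₃ → H₂ ≢ H₃ →
                  IsFlatOfCorank 2 (value H₁ ∩ value H₂ ∩ value H₃) → ThreeTerm H₁ H₂ H₃)
    (trivial : ∀ θ → TrivialCrossRatio θ)
    where

    private
      q : Hyperplane → Fin n → Fin n → Carrier
      q H e f = φ H e ∙ φ H f ⁻¹

    q-hexagon : ∀ H₁ H₂ H₃ → IsFlatOfCorank 2 (value H₁ ∩ value H₂ ∩ value H₃) → ∀ {e₁ e₂ e₃} →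
      e₁ ∈ value H₁ → e₁ ∉ value H₂ → e₁ ∉ value H₃ →
      e₂ ∉ value H₁ → e₂ ∈ value H₂ → e₂ ∉ value H₃ →
      e₃ ∉ value H₁ → e₃ ∉ value H₂ → e₃ ∈ value H₃ →
      q H₃ e₁ e₂ ∙ q H₁ e₂ e₃ ≈ q H₂ e₁ e₃
    q-hexagon H₁ H₂ H₃ corank2 e₁∈H₁ e₁∉H₂ e₁∉H₃ e₂∉H₁ e₂∈H₂ e₂∉H₃ e₃∉H₁ e₃∉H₂ e₃∈H₃ =
      hexagon (ratio₁ e₁∈H₁ e₁∉H₂ e₁∉H₃) (ratio₂ e₂∉H₁ e₂∈H₂ e₂∉H₃) (ratio₃ e₃∉H₁ e₃∉H₂ e₃∈H₃)
      where
      value-≢ : ∀ {H H′ e} → e ∈ value H → e ∉ value H′ → H ≢ H′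
      value-≢ e∈H e∉H′ ≡-refl = e∉H′ e∈H
      open ThreeTerm (three-term H₁ H₂ H₃ (value-≢ {H₁} {H₂} e₁∈H₁ e₁∉H₂)
        (value-≢ {H₁} {H₃} e₁∈H₁ e₁∉H₃) (value-≢ {H₂} {H₃} e₂∈H₂ e₂∉H₃) corank2)

    module _ (H₁ H₂ : Hyperplane) (corank2 : IsFlatOfCorank 2 (value H₁ ∩ value H₂)) where

      L : Subset n
      L = value H₁ ∩ value H₂

      L⊆H₁ : L ⊆ value H₁
      L⊆H₁ = p∩q⊆p (value H₁) (value H₂)

      L⊆H₂ : L ⊆ value H₂
      L⊆H₂ = p∩q⊆q (value H₁) (value H₂)

      H₁≢H₂ : H₁ ≢ H₂
      H₁≢H₂ ≡-refl = <-irrefl ≡-refl (≤-trans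
        (≤-reflexive (suc-injective (≡-trans (proj₂ corank2) (≡-sym (r-hyperplane H₁)))))
        (monotone {value H₁} {L} (λ e∈ → x∈p∩q⁺ (e∈ , e∈))))

      module Through {e} (e∉H₁ : e ∉ value H₁) (e∉H₂ : e ∉ value H₂) where

        H₃ : Hyperplane
        H₃ = hyperplane (L ∪ ⁅ e ⁆) (≤-antisym
          (≤-trans (s≤s (r-insert e)) (≤-reflexive (proj₂ corank2)))
          (≤-trans (≤-reflexive (≡-sym (proj₂ corank2))) (s≤s (proj₁ corank2 (e∉H₁ ∘ L⊆H₁)))))

        L⊆H₃ : L ⊆ value H₃
        L⊆H₃ = ⊆-cl ∘ ∈-∪ˡ

        e∈H₃ : e ∈ value H₃
        e∈H₃ = ⊆-cl ∈-insert

        meet : ∀ H → L ⊆ value H → e ∉ value H → L ≡ value H ∩ value H₃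
        meet H L⊆H e∉H = ⊆-antisym (λ x∈L → x∈p∩q⁺ (L⊆H x∈L , L⊆H₃ x∈L))
          (λ {x} x∈ → let x∈H , x∈H₃ = x∈p∩q⁻ (value H) (value H₃) x∈ in
            decidable-stable (x ∈? L) λ x∉L →
              pencil-disjoint (proj₂ corank2) {H₃} {H} L⊆H₃ L⊆H e∈H₃ e∉H x∈H₃ (proj₁ corank2 x∉L) x∈H)

        L≡H₁∩H₃ : L ≡ value H₁ ∩ value H₃
        L≡H₁∩H₃ = meet H₁ L⊆H₁ e∉H₁

        L≡H₂∩H₃ : L ≡ value H₂ ∩ value H₃
        L≡H₂∩H₃ = meet H₂ L⊆H₂ e∉H₂

        corank2′ : IsFlatOfCorank 2 (value H₁ ∩ value H₂ ∩ value H₃)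
        corank2′ = subst (IsFlatOfCorank 2)
          (⊆-antisym (λ x∈L → x∈p∩q⁺ (L⊆H₁ x∈L , x∈p∩q⁺ (L⊆H₂ x∈L , L⊆H₃ x∈L)))
                     (λ x∈ → let x∈H₁ , x∈H₂∩H₃ = x∈p∩q⁻ (value H₁) (value H₂ ∩ value H₃) x∈
                             in x∈p∩q⁺ (x∈H₁ , p∩q⊆p (value H₂) (value H₃) x∈H₂∩H₃)))
          corank2

        open ThreeTerm (three-term H₁ H₂ H₃ H₁≢H₂
          (λ H₁≡H₃ → e∉H₁ (subst (λ H → e ∈ value H) (≡-sym H₁≡H₃) e∈H₃))
          (λ H₂≡H₃ → e∉H₂ (subst (λ H → e ∈ value H) (≡-sym H₂≡H₃) e∈H₃)) corank2′) public
            using (ratio₃)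

        -- On `H₃` outside `H₁` and `H₂`, the quotient of `φ H₁` by `φ H₂` is constant by the
        -- three-term relation; this allows `e` to be replaced by a chosen point of a cross-ratio.
        constant-ratio : ∀ {a} → a ∈ value H₃ → a ∉ value H₁ → a ∉ value H₂ →
                         φ H₁ e ∙ φ H₂ a ≈ φ H₂ e ∙ φ H₁ a
        constant-ratio a∈H₃ a∉H₁ a∉H₂ =
          cross-multiply (ratio₃ e∉H₁ e∉H₂ e∈H₃) (ratio₃ a∉H₁ a∉H₂ a∈H₃)

      -- The quotient of `φ H₁` by `φ H₂` is carried from `e` to the chosen point `a` in the same
      -- member of the pencil, by the trivial cross-ratio to `b`, and from there to `f`. The members
      -- through `e` and `f` may coincide, which `Θ` permits.
      q-adjacent : ∀ {e f} → e ∉ value H₁ → f ∉ value H₁ → e ∉ value H₂ → f ∉ value H₂ →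
                   q H₁ e f ≈ q H₂ e f
      q-adjacent {e} {f} e∉H₁ f∉H₁ e∉H₂ f∉H₂ = fractions-≈ (transfer
        (E.constant-ratio a∈H₃ a∉H₁ a∉H₂) (F.constant-ratio b∈H₄ b∉H₁ b∉H₂) (trivial θ))
        where
        module E = Through e∉H₁ e∉H₂
        module F = Through f∉H₁ f∉H₂
        L≡ : L ≡ value H₁ ∩ value H₂ ∩ value E.H₃ ∩ value F.H₃
        L≡ = ⊆-antisym
          (λ x∈L → x∈p∩q⁺ (L⊆H₁ x∈L , x∈p∩q⁺ (L⊆H₂ x∈L , x∈p∩q⁺ (E.L⊆H₃ x∈L , F.L⊆H₃ x∈L))))
          (λ x∈ → let x∈H₁ , x∈′ = x∈p∩q⁻ (value H₁) _ x∈
                  in x∈p∩q⁺ (x∈H₁ , p∩q⊆p (value H₂) (value E.H₃ ∩ value F.H₃) x∈′))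
        θ : Θ M
        θ = record
          { H₁ = H₁ ; H₂ = H₂ ; H₃ = E.H₃ ; H₄ = F.H₃
          ; corank2 = subst (IsFlatOfCorank 2) L≡ corank2
          ; L≡H₁∩H₃ = ≡-trans (≡-sym L≡) E.L≡H₁∩H₃
          ; L≡H₁∩H₄ = ≡-trans (≡-sym L≡) F.L≡H₁∩H₃
          ; L≡H₂∩H₃ = ≡-trans (≡-sym L≡) E.L≡H₂∩H₃
          ; L≡H₂∩H₄ = ≡-trans (≡-sym L≡) F.L≡H₂∩H₃
          }
        open Choice (choice θ)
        avoids : ∀ {H H′ x} → Θ.L θ ≡ value H ∩ value H′ → x ∈ value H′ → x ∉ Θ.L θ → x ∉ value H
        avoids {H} {H′} L≡H∩H′ x∈H′ x∉L x∈H = x∉L (subst (_ ∈_) (≡-sym L≡H∩H′) (x∈p∩q⁺ (x∈H , x∈H′)))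
        a∉H₁ : a ∉ value H₁
        a∉H₁ = avoids {H₁} {E.H₃} (Θ.L≡H₁∩H₃ θ) a∈H₃ a∉L
        a∉H₂ : a ∉ value H₂
        a∉H₂ = avoids {H₂} {E.H₃} (Θ.L≡H₂∩H₃ θ) a∈H₃ a∉L
        b∉H₁ : b ∉ value H₁
        b∉H₁ = avoids {H₁} {F.H₃} (Θ.L≡H₁∩H₄ θ) b∈H₄ b∉L
        b∉H₂ : b ∉ value H₂
        b∉H₂ = avoids {H₂} {F.H₃} (Θ.L≡H₂∩H₄ θ) b∈H₄ b∉L

    rescaled : Σ[ α ∈ (Hyperplane → Carrier) ] Σ[ t ∈ (Fin n → Carrier) ]
               ∀ H {e} → e ∉ value H → φ H e ≈ α H ∙ t e
    -- The factor of `H` is read off at an arbitrary point outside `H`.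
    rescaled = (λ H → φ H (point H) ∙ t (point H) ⁻¹) , t , φ≈αt
      where
      potential : Σ[ t ∈ (Fin n → Carrier) ] ∀ H {e f} → e ∉ value H → f ∉ value H → q H e f ≈ t e ∙ t f ⁻¹
      potential = Ratios.q-potential M group q (λ H e f g → fraction-trans (φ H e) (φ H f) (φ H g))
                                     q-adjacent q-hexagon
      t : Fin n → Carrier
      t = proj₁ potential
      outer : ∀ H → ∃[ e ] e ∈ full × e ∉ value H
      outer H = r<⇒∃ (≤-reflexive (r-hyperplane H))
      point : Hyperplane → Fin n
      point H = proj₁ (outer H)
      φ≈αt : ∀ H {e} → e ∉ value H → φ H e ≈ (φ H (point H) ∙ t (point H) ⁻¹) ∙ t e
      φ≈αt H {e} e∉H = begin
        φ H e                             ≈⟨ //-rightDividesˡ (φ H f) (φ H e) ⟨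
        (φ H e ∙ φ H f ⁻¹) ∙ φ H f        ≈⟨ ∙-congʳ (proj₂ potential H e∉H (proj₂ (proj₂ (outer H)))) ⟩
        (t e ∙ t f ⁻¹) ∙ φ H f            ≈⟨ comm _ _ ⟩
        φ H f ∙ (t e ∙ t f ⁻¹)            ≈⟨ ∙-congˡ (comm _ _) ⟩
        φ H f ∙ (t f ⁻¹ ∙ t e)            ≈⟨ assoc _ _ _ ⟨
        (φ H f ∙ t f ⁻¹) ∙ t e            ∎
        where
        f : Fin n
        f = point H
        open SetoidReasoning setoid
        open AbelianGroupProperties 𝔾 using (//-rightDividesˡ)

-- The subpasture spanned by a set of units and -1.

module _ (P : Pasture ℓ) where

  open Pasture P renaming (zero to *-zero)

  unitAbelianGroup : AbelianGroup ℓ ℓ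
  unitAbelianGroup = record
    { isAbelianGroup = record
      { isGroup = Group.isGroup unitGroup ; comm = λ (a , _) (b , _) → comm a b } }

  open SetoidReasoning setoid

  null-neg : ∀ a → Null a (a * - 1#) 0#
  null-neg a = Null-resp (identityʳ a) refl (proj₂ *-zero a) (Null-scale a (proj₁ (proj₂ (negation 1#))))

  null-pair : ∀ {a b} → Null a b 0# → b ≈ a * - 1#
  null-pair {a} null = trans (≈-sym (unique null)) (unique (null-neg a))
    where
    unique : ∀ {b} → Null a b 0# → - a ≈ b
    unique = proj₂ (proj₂ (negation a))

  *-cancel-0 : ∀ {a} (u : Unit) → proj₁ u * a ≈ 0# → a ≈ 0#
  *-cancel-0 {a} u ua≈0 = begin
    a                            ≈⟨ identityˡ a ⟨
    1# * a                       ≈⟨ *-congʳ (inverseˡᵘ u) ⟨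
    proj₁ (u ⁻¹ᵘ) * proj₁ u * a  ≈⟨ assoc _ _ _ ⟩
    proj₁ (u ⁻¹ᵘ) * (proj₁ u * a) ≈⟨ *-congˡ ua≈0 ⟩
    proj₁ (u ⁻¹ᵘ) * 0#           ≈⟨ proj₂ *-zero _ ⟩
    0#                           ∎

  module _ (S : Pred Unit ℓ) where

    private
      -1∪S : Pred Unit ℓ
      -1∪S v = S v ⊎ proj₁ v ≈ proj₁ -1ᵘ

    -- The alternative is kept as data, since being zero is not assumed decidable in `P`.
    Spanned : Pred Carrier ℓ
    Spanned a = a ≈ 0# ⊎ ∃[ a≉0 ] Span unitGroup -1∪S (a , a≉0)

    spanned-* : ∀ {a b} → Spanned a → Spanned b → Spanned (a * b)
    spanned-* (inj₁ a≈0) _ = inj₁ (trans (*-congʳ a≈0) (proj₁ *-zero _))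
    spanned-* (inj₂ _) (inj₁ b≈0) = inj₁ (trans (*-congˡ b≈0) (proj₂ *-zero _))
    spanned-* (inj₂ (a≉0 , a∈)) (inj₂ (b≉0 , b∈)) = inj₂ (*-≉0 a≉0 b≉0 , mul a∈ b∈)

    spanPasture : Pasture ℓ
    spanPasture = record
      { pointedGroup = record
        { Carrier = ∃[ a ] Spanned a
        ; _≈_     = λ (a , _) (b , _) → a ≈ b
        ; _*_     = λ (a , a∈) (b , b∈) → a * b , spanned-* a∈ b∈
        ; 0#      = 0# , inj₁ refl
        ; 1#      = 1# , inj₂ (_ , unit)
        ; isCommutativeMonoid = record
          { isMonoid = record
            { isSemigroup = record
              { isMagma = record
                { isEquivalence = record { refl = refl ; sym = ≈-sym ; trans = trans }
                ; ∙-cong        = *-cong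
                }
              ; assoc = λ (a , _) (b , _) (c , _) → assoc a b c
              }
            ; identity = (λ (a , _) → identityˡ a) , (λ (a , _) → identityʳ a)
            }
          ; comm = λ (a , _) (b , _) → comm a b
          }
        ; zero    = (λ (a , _) → proj₁ *-zero a) , (λ (a , _) → proj₂ *-zero a)
        ; 0≉1     = 0≉1
        ; inverse = λ where
            (a , inj₁ a≈0)        a≉0 → contradiction a≈0 a≉0
            (a , inj₂ (a≉0 , a∈)) _   →
              (_ , inj₂ (_ , inv a∈)) , inverseʳᵘ (a , a≉0)
        }
      ; Null       = λ (a , _) (b , _) (c , _) → Null a b c
      ; Null-resp  = Null-resp
      ; Null-swap₁ = Null-swap₁
      ; Null-swap₂ = Null-swap₂
      ; Null-scale = λ (d , _) → Null-scale d
      -- Negatives stay in the subpasture because -1 is one of the generators.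
      ; negation   = λ (a , a∈) →
          (a * - 1# , spanned-* a∈ (inj₂ (proj₂ -1ᵘ , gen (inj₂ refl)))) ,
          null-neg a , λ null → ≈-sym (null-pair null)
      }

    inclusion : PastureHom spanPasture P
    inclusion = record
      { ⟦_⟧ = proj₁
      ; isMonoidHomomorphism = record
        { isMagmaHomomorphism = record
          { isRelHomomorphism = record { cong = id }
          ; homo              = λ _ _ → refl
          }
        ; ε-homo = refl
        }
      ; 0#-homo   = refl
      ; Null-homo = id
      }

pushforward-∼ : ∀ {M : Matroid n} {P Q : Pasture ℓ} (g : PastureHom P Q) {ρ ρ′ : Representation M P} →
                _∼_ M P ρ ρ′ → _∼_ M Q (pushforward g ρ) (pushforward g ρ′)
pushforward-∼ {Q = Q} g ρ∼ρ′ = record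
  { α       = λ H → _ , ≉0-homo (proj₂ (α H))
  ; t       = λ e → _ , ≉0-homo (proj₂ (t e))
  ; rescale = λ H e → trans (⟦⟧-cong (rescale H e)) (trans (*-homo _ _) (*-congʳ (*-homo _ _)))
  }
  where
  open PastureHom g
  open Pasture Q using (trans; *-congʳ)
  open _∼_ ρ∼ρ′

-- Rescaling a representation into the span of its cross-ratios.

module CrossRatioSpan (M : Matroid n) (P : Pasture ℓ) (ρ : Representation M P)
                      (choice : ∀ θ → Choice M θ) where

  open Matroid M renaming (rank to r)
  open MatroidProperties M
  open Pasture P renaming (zero to *-zero)
  open Representation ρ

  private
    -1∪CR : Pred Unit ℓ
    -1∪CR v = CrossRatios ρ choice v ⊎ proj₁ v ≈ proj₁ -1ᵘ

    𝕌 ℚ : AbelianGroup ℓ ℓ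
    𝕌 = unitAbelianGroup P
    ℚ = quotient 𝕌 -1∪CR

    module U = AbelianGroup 𝕌
    module Q = AbelianGroup ℚ
    open U using (_∙_; ε; _⁻¹)

    φ≈0 : ∀ {H e} → e ∈ value H → φ H e ≈ 0#
    φ≈0 {H} {e} = Equivalence.from (vanishing H e)

    φ̂-dec : ∀ {H e} → Dec (e ∈ value H) → Unit
    φ̂-dec         (yes _)   = ε
    φ̂-dec {H} {e} (no e∉H) = φᵘ H e e∉H

    -- Takes the junk value 1 where φ vanishes.
    φ̂ : Hyperplane → Fin n → Unit
    φ̂ H e = φ̂-dec {H} {e} (e ∈? value H)

    φ̂-∉ : ∀ H e → e ∉ value H → proj₁ (φ̂ H e) ≈ φ H e
    φ̂-∉ H e e∉H with e ∈? value H
    ... | yes e∈H = contradiction e∈H e∉H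
    ... | no  _   = refl

  private
    open module T = TrivialCrossRatios M ℚ choice φ̂ using (TrivialCrossRatio)

  module Coefficients (H₁ H₂ H₃ : Hyperplane) (H₁≢H₂ : H₁ ≢ H₂) (H₁≢H₃ : H₁ ≢ H₃) (H₂≢H₃ : H₂ ≢ H₃)
                   (corank2 : IsFlatOfCorank 2 (value H₁ ∩ value H₂ ∩ value H₃)) where

    private
      L : Subset n
      L = value H₁ ∩ value H₂ ∩ value H₃

      L⊆H₁ : L ⊆ value H₁
      L⊆H₁ = p∩q⊆p (value H₁) (value H₂ ∩ value H₃)
      L⊆H₂ : L ⊆ value H₂
      L⊆H₂ = p∩q⊆p (value H₂) (value H₃) ∘ p∩q⊆q (value H₁) (value H₂ ∩ value H₃)
      L⊆H₃ : L ⊆ value H₃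
      L⊆H₃ = p∩q⊆q (value H₂) (value H₃) ∘ p∩q⊆q (value H₁) (value H₂ ∩ value H₃)

      disjoint : ∀ {H H′} → H ≢ H′ → L ⊆ value H → L ⊆ value H′ → ∀ {x} → x ∈ value H → x ∉ L → x ∉ value H′
      disjoint {H} {H′} H≢H′ L⊆H L⊆H′ x∈H x∉L with ∃-or-⊆ (value H) (value H′)
      ... | inj₂ H⊆H′              = contradiction (⊆⇒≡-hyperplane {H} {H′} H⊆H′) H≢H′
      ... | inj₁ (i , i∈H , i∉H′) =
        pencil-disjoint (proj₂ corank2) {H} {H′} L⊆H L⊆H′ i∈H i∉H′ x∈H (proj₁ corank2 x∉L)

      point : ∀ H → ∃[ e ] e ∈ value H × e ∉ L
      point H = r<⇒∃ (≤-reflexive (suc-injective (≡-trans (proj₂ corank2) (≡-sym (r-hyperplane H)))))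

      e₁ e₂ e₃ : Fin n
      e₁ = proj₁ (point H₁)
      e₂ = proj₁ (point H₂)
      e₃ = proj₁ (point H₃)

      term : ∃[ a ] ∃[ b ] ∃[ c ] ¬ (a ≈ 0# × b ≈ 0# × c ≈ 0#) ×
             (∀ e → Null (a * φ H₁ e) (b * φ H₂ e) (c * φ H₃ e))
      term = three-term H₁ H₂ H₃ H₁≢H₂ H₁≢H₃ H₂≢H₃ corank2

      a b c : Carrier
      a = proj₁ term
      b = proj₁ (proj₂ term)
      c = proj₁ (proj₂ (proj₂ term))

      nonzero : ¬ (a ≈ 0# × b ≈ 0# × c ≈ 0#)
      nonzero = proj₁ (proj₂ (proj₂ (proj₂ term)))

    null : ∀ e → Null (a * φ H₁ e) (b * φ H₂ e) (c * φ H₃ e)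
    null = proj₂ (proj₂ (proj₂ (proj₂ term)))

    private
      drop : ∀ {x H e} → e ∈ value H → x * φ H e ≈ 0#
      drop {x} {H} e∈H = trans (*-congˡ (φ≈0 {H} e∈H)) (proj₂ *-zero x)

      null₁ : ∀ {e} → e ∈ value H₁ → Null (b * φ H₂ e) (c * φ H₃ e) 0#
      null₁ {e} e∈H₁ = Null-swap₂ (Null-swap₁ (Null-resp (drop {H = H₁} e∈H₁) refl refl (null e)))

      null₂ : ∀ {e} → e ∈ value H₂ → Null (a * φ H₁ e) (c * φ H₃ e) 0#
      null₂ {e} e∈H₂ = Null-swap₂ (Null-resp refl (drop {H = H₂} e∈H₂) refl (null e))

      null₃ : ∀ {e} → e ∈ value H₃ → Null (a * φ H₁ e) (b * φ H₂ e) 0#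
      null₃ {e} e∈H₃ = Null-resp refl refl (drop {H = H₃} e∈H₃) (null e)

      zero-pair : ∀ {x y H H′ e} → e ∉ value H′ → Null (x * φ H e) (y * φ H′ e) 0# → x ≈ 0# → y ≈ 0#
      zero-pair {x} {y} {H} {H′} {e} e∉H′ pair x≈0 = *-cancel-0 P (φᵘ H′ e e∉H′) (begin
        φ H′ e * y            ≈⟨ comm _ _ ⟩
        y * φ H′ e            ≈⟨ null-pair P pair ⟩
        x * φ H e * - 1#      ≈⟨ *-congʳ (trans (*-congʳ x≈0) (proj₁ *-zero _)) ⟩
        0# * - 1#             ≈⟨ proj₁ *-zero _ ⟩
        0#                    ∎)
        where open SetoidReasoning setoid

      ∉₁ : ∀ {e} → e ∈ value H₁ → e ∉ L → e ∉ value H₂ × e ∉ value H₃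
      ∉₁ e∈ e∉L = disjoint {H₁} {H₂} H₁≢H₂ L⊆H₁ L⊆H₂ e∈ e∉L ,
                  disjoint {H₁} {H₃} H₁≢H₃ L⊆H₁ L⊆H₃ e∈ e∉L

      ∉₂ : ∀ {e} → e ∈ value H₂ → e ∉ L → e ∉ value H₁ × e ∉ value H₃
      ∉₂ e∈ e∉L = disjoint {H₂} {H₁} (H₁≢H₂ ∘ ≡-sym) L⊆H₂ L⊆H₁ e∈ e∉L ,
                  disjoint {H₂} {H₃} H₂≢H₃ L⊆H₂ L⊆H₃ e∈ e∉L

      ∉₃ : ∀ {e} → e ∈ value H₃ → e ∉ L → e ∉ value H₁ × e ∉ value H₂
      ∉₃ e∈ e∉L = disjoint {H₃} {H₁} (H₁≢H₃ ∘ ≡-sym) L⊆H₃ L⊆H₁ e∈ e∉L ,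
                  disjoint {H₃} {H₂} (H₂≢H₃ ∘ ≡-sym) L⊆H₃ L⊆H₂ e∈ e∉L

      e₁∈ = proj₁ (proj₂ (point H₁))
      e₂∈ = proj₁ (proj₂ (point H₂))
      e₃∈ = proj₁ (proj₂ (point H₃))
      e₁∉ = ∉₁ e₁∈ (proj₂ (proj₂ (point H₁)))
      e₂∉ = ∉₂ e₂∈ (proj₂ (proj₂ (point H₂)))
      e₃∉ = ∉₃ e₃∈ (proj₂ (proj₂ (point H₃)))

      -- At a point of `H₃` alone only the terms of `a` and `b` remain, and at a point of `H₂` alone
      -- those of `a` and `c`; so `a` cannot vanish without the other two.
      a≉0 : a ≉ 0#
      a≉0 a≈0 = nonzero (a≈0 , zero-pair {H = H₁} {H₂} (proj₂ e₃∉) (null₃ e₃∈) a≈0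
                             , zero-pair {H = H₁} {H₃} (proj₂ e₂∉) (null₂ e₂∈) a≈0)

      b≉0 : b ≉ 0#
      b≉0 b≈0 = a≉0 (zero-pair {H = H₂} {H₁} (proj₁ e₃∉) (Null-swap₁ (null₃ e₃∈)) b≈0)

      c≉0 : c ≉ 0#
      c≉0 c≈0 = a≉0 (zero-pair {H = H₃} {H₁} (proj₁ e₂∉) (Null-swap₁ (null₂ e₂∈)) c≈0)

    aᵘ bᵘ cᵘ : Unit
    aᵘ = a , a≉0
    bᵘ = b , b≉0
    cᵘ = c , c≉0

    private
      -- The second term is -1 times the first, and -1 lies in the subgroup divided out.
      pair-≋ : ∀ {H H′ e} (u v : Unit) → e ∉ value H → e ∉ value H′ →
               Null (proj₁ u * φ H e) (proj₁ v * φ H′ e) 0# → v ∙ φ̂ H′ e Q.≈ u ∙ φ̂ H e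
      pair-≋ {H} {H′} {e} u v e∉H e∉H′ pair = modulo (resp {x = -1ᵘ} {y = (v ∙ φ̂ H′ e) ∙ y ⁻¹}
        (≈-sym (begin
          proj₁ v * proj₁ (φ̂ H′ e) * y′         ≈⟨ *-congʳ (*-congˡ (φ̂-∉ H′ e e∉H′)) ⟩
          proj₁ v * φ H′ e * y′                 ≈⟨ *-congʳ (null-pair P pair) ⟩
          proj₁ u * φ H e * - 1# * y′           ≈⟨ *-congʳ (*-congʳ (*-congˡ (φ̂-∉ H e e∉H))) ⟨
          proj₁ y * - 1# * y′                   ≈⟨ *-congʳ (comm _ _) ⟩
          - 1# * proj₁ y * y′                   ≈⟨ assoc _ _ _ ⟩
          - 1# * (proj₁ y * y′)                 ≈⟨ *-congˡ (inverseʳᵘ y) ⟩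
          - 1# * 1#                             ≈⟨ identityʳ _ ⟩
          - 1#                                  ∎))
        (gen (inj₂ refl)))
        where
        open SetoidReasoning setoid
        y : Unit
        y = u ∙ φ̂ H e
        y′ : Carrier
        y′ = proj₁ (y ⁻¹)

    ratio₁ : ∀ {e} → e ∈ value H₁ → e ∉ value H₂ → e ∉ value H₃ → cᵘ ∙ φ̂ H₃ e Q.≈ bᵘ ∙ φ̂ H₂ e
    ratio₁ e∈H₁ e∉H₂ e∉H₃ = pair-≋ {H₂} {H₃} bᵘ cᵘ e∉H₂ e∉H₃ (null₁ e∈H₁)

    ratio₂ : ∀ {e} → e ∉ value H₁ → e ∈ value H₂ → e ∉ value H₃ → cᵘ ∙ φ̂ H₃ e Q.≈ aᵘ ∙ φ̂ H₁ e
    ratio₂ e∉H₁ e∈H₂ e∉H₃ = pair-≋ {H₁} {H₃} aᵘ cᵘ e∉H₁ e∉H₃ (null₂ e∈H₂)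

    ratio₃ : ∀ {e} → e ∉ value H₁ → e ∉ value H₂ → e ∈ value H₃ → bᵘ ∙ φ̂ H₂ e Q.≈ aᵘ ∙ φ̂ H₁ e
    ratio₃ e∉H₁ e∉H₂ e∈H₃ = pair-≋ {H₁} {H₂} aᵘ bᵘ e∉H₁ e∉H₂ (null₃ e∈H₃)

    point₂ : ∃[ e ] e ∉ value H₁ × e ∈ value H₂ × e ∉ value H₃
    point₂ = e₂ , proj₁ e₂∉ , e₂∈ , proj₂ e₂∉

    point₃ : ∃[ e ] e ∉ value H₁ × e ∉ value H₂ × e ∈ value H₃
    point₃ = e₃ , proj₁ e₃∉ , proj₂ e₃∉ , e₃∈

    ratios : T.ThreeTerm H₁ H₂ H₃
    ratios = record
      { a = aᵘ ; b = bᵘ ; c = cᵘ ; ratio₁ = ratio₁ ; ratio₂ = ratio₂ ; ratio₃ = ratio₃ }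

  private
    //-congᵘ : ∀ u v u′ v′ → proj₁ u ≈ proj₁ u′ → proj₁ v ≈ proj₁ v′ →
               proj₁ (u ∙ v ⁻¹) ≈ proj₁ (u′ ∙ v′ ⁻¹)
    //-congᵘ u v u′ v′ u≈u′ v≈v′ = *-cong u≈u′ (U.⁻¹-cong {v} {v′} v≈v′)

    trivial : ∀ θ → TrivialCrossRatio θ
    trivial θ = modulo (resp
      {x = crossRatio ρ θ (choice θ)} {y = (φ̂ H₁ a ∙ φ̂ H₂ b) ∙ (φ̂ H₁ b ∙ φ̂ H₂ a) ⁻¹}
      (//-congᵘ
        (φᵘ H₁ a (∉ L≡H₁∩H₃ a∈H₃ a∉L) ∙ φᵘ H₂ b (∉ L≡H₂∩H₄ b∈H₄ b∉L))
        (φᵘ H₁ b (∉ L≡H₁∩H₄ b∈H₄ b∉L) ∙ φᵘ H₂ a (∉ L≡H₂∩H₃ a∈H₃ a∉L))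
        (φ̂ H₁ a ∙ φ̂ H₂ b) (φ̂ H₁ b ∙ φ̂ H₂ a)
        (*-cong (≈-sym (φ̂-∉ H₁ a (∉ L≡H₁∩H₃ a∈H₃ a∉L))) (≈-sym (φ̂-∉ H₂ b (∉ L≡H₂∩H₄ b∈H₄ b∉L))))
        (*-cong (≈-sym (φ̂-∉ H₁ b (∉ L≡H₁∩H₄ b∈H₄ b∉L))) (≈-sym (φ̂-∉ H₂ a (∉ L≡H₂∩H₃ a∈H₃ a∉L)))))
      (gen (inj₁ (θ , refl))))
      where
      open Θ θ
      open Choice (choice θ)
      ∉ : ∀ {A B e} → L ≡ A ∩ B → e ∈ B → e ∉ L → e ∉ A
      ∉ L≡A∩B e∈B e∉L e∈A = e∉L (subst (_ ∈_) (≡-sym L≡A∩B) (x∈p∩q⁺ (e∈A , e∈B)))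

    -- Opaque, since the witnesses unfold to enormous terms.
    abstract
      rescaling : Σ[ α ∈ (Hyperplane → Unit) ] Σ[ t ∈ (Fin n → Unit) ]
                  ∀ H {e} → e ∉ value H → φ̂ H e Q.≈ α H ∙ t e
      rescaling = T.rescaled Coefficients.ratios trivial

    α : Hyperplane → Unit
    α = proj₁ rescaling

    t : Fin n → Unit
    t = proj₁ (proj₂ rescaling)

  crossRatioPasture : Pasture ℓ
  crossRatioPasture = spanPasture P (CrossRatios ρ choice)

  private
    module C = Pasture crossRatioPasture

    ψ-dec : ∀ H e → Dec (e ∈ value H) → C.Carrier
    ψ-dec H e (yes _)   = C.0#
    ψ-dec H e (no e∉H) =
      _ , inj₂ (proj₂ (φ̂ H e ∙ (α H ∙ t e) ⁻¹) , _≋_.quotient∈span (proj₂ (proj₂ rescaling) H e∉H))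

    ψ : Hyperplane → Fin n → C.Carrier
    ψ H e = ψ-dec H e (e ∈? value H)

    rescaled : ∀ H e → φ H e ≈ proj₁ (α H) * proj₁ (t e) * proj₁ (ψ H e)
    rescaled H e with e ∈? value H
    ... | yes e∈H = trans (φ≈0 {H} e∈H) (≈-sym (proj₂ *-zero _))
    ... | no  e∉H = begin
      φ H e                                    ≈⟨ identityˡ (φ H e) ⟨
      1# * φ H e                               ≈⟨ *-congʳ (inverseʳᵘ u) ⟨
      proj₁ u * proj₁ (u ⁻¹) * φ H e           ≈⟨ assoc _ _ _ ⟩
      proj₁ u * (proj₁ (u ⁻¹) * φ H e)         ≈⟨ *-congˡ (comm _ _) ⟩
      proj₁ u * (φ H e * proj₁ (u ⁻¹))         ≈⟨ *-congˡ (*-congʳ (φ̂-∉ H e e∉H)) ⟨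
      proj₁ u * (proj₁ (φ̂ H e) * proj₁ (u ⁻¹)) ∎
      where
      open SetoidReasoning setoid
      u : Unit
      u = α H ∙ t e

    -- Modulo the span, `φ̂ H e` is `α H ∙ t e`, and `t e` cancels. This relates the coefficients
    -- that belong to the rescaled hyperplane functions.
    rest-coefficient : ∀ {H H′ e} (x y : Unit) → e ∉ value H → e ∉ value H′ →
                       y ∙ φ̂ H′ e Q.≈ x ∙ φ̂ H e → y ∙ α H′ Q.≈ x ∙ α H
    rest-coefficient {H} {H′} {e} x y e∉H e∉H′ ratio = ∙-cancelʳ (t e) _ _ (begin
      (y ∙ α H′) ∙ t e    ≈⟨ Q.assoc y (α H′) (t e) ⟩
      y ∙ (α H′ ∙ t e)    ≈⟨ Q.∙-congˡ {y} (proj₂ (proj₂ rescaling) H′ e∉H′) ⟨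
      y ∙ φ̂ H′ e          ≈⟨ ratio ⟩
      x ∙ φ̂ H e           ≈⟨ Q.∙-congˡ {x} (proj₂ (proj₂ rescaling) H e∉H) ⟩
      x ∙ (α H ∙ t e)     ≈⟨ Q.assoc x (α H) (t e) ⟨
      (x ∙ α H) ∙ t e     ∎)
      where
      open SetoidReasoning Q.setoid
      open AbelianGroupProperties ℚ using (∙-cancelʳ)

    -- The coefficients absorb the factors `α` and are divided by `A`, so that the first becomes 1.
    -- Comparison at a point of `H₃` alone and at one of `H₂` alone shows that the other two lie in
    -- the span.
    ψ-three-term : ∀ H₁ H₂ H₃ → H₁ ≢ H₂ → H₁ ≢ H₃ → H₂ ≢ H₃ →
      IsFlatOfCorank 2 (value H₁ ∩ value H₂ ∩ value H₃) →
      ∃[ a ] ∃[ b ] ∃[ c ] ¬ (a C.≈ C.0# × b C.≈ C.0# × c C.≈ C.0#) ×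
      (∀ e → C.Null (a C.* ψ H₁ e) (b C.* ψ H₂ e) (c C.* ψ H₃ e))
    ψ-three-term H₁ H₂ H₃ H₁≢H₂ H₁≢H₃ H₂≢H₃ corank2 =
      C.1# , coefficient b∈ , coefficient c∈ , (λ (1≈0 , _) → 0≉1 (≈-sym 1≈0)) , λ e →
      Null-resp (normalise₁ e) (normalise e bᵘ) (normalise e cᵘ) (Null-scale (proj₁ ((A ∙ t e) ⁻¹)) (null e))
      where
      open Coefficients H₁ H₂ H₃ H₁≢H₂ H₁≢H₃ H₂≢H₃ corank2
      A : Unit
      A = aᵘ ∙ α H₁
      b∈ : bᵘ ∙ α H₂ Q.≈ A
      b∈ = let e , e∉H₁ , e∉H₂ , e∈H₃ = point₃ in
        rest-coefficient {H₁} {H₂} aᵘ bᵘ e∉H₁ e∉H₂ (ratio₃ e∉H₁ e∉H₂ e∈H₃)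
      c∈ : cᵘ ∙ α H₃ Q.≈ A
      c∈ = let e , e∉H₁ , e∈H₂ , e∉H₃ = point₂ in
        rest-coefficient {H₁} {H₃} aᵘ cᵘ e∉H₁ e∉H₃ (ratio₂ e∉H₁ e∈H₂ e∉H₃)
      coefficient : ∀ {B} → B Q.≈ A → C.Carrier
      coefficient {B} (modulo B//A) = proj₁ (B ∙ A ⁻¹) , inj₂ (proj₂ (B ∙ A ⁻¹) , B//A)
      normalise : ∀ e (x : Unit) {H} →
                  proj₁ ((A ∙ t e) ⁻¹) * (proj₁ x * φ H e) ≈ proj₁ ((x ∙ α H) ∙ A ⁻¹) * proj₁ (ψ H e)
      normalise e (x , _) {H} = begin
        w * (x * φ H e)            ≈⟨ *-congˡ (*-congˡ (rescaled H e)) ⟩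
        w * (x * (αH * te * ψHe))  ≈⟨ x∙yz≈y∙xz _ _ _ ⟩
        x * (w * (αH * te * ψHe))  ≈⟨ *-congˡ (assoc _ _ _) ⟨
        x * (w * (αH * te) * ψHe)  ≈⟨ *-congˡ (*-congʳ (x∙yz≈y∙xz _ _ _)) ⟩
        x * (αH * (w * te) * ψHe)  ≈⟨ assoc _ _ _ ⟨
        x * (αH * (w * te)) * ψHe  ≈⟨ *-congʳ (assoc _ _ _) ⟨
        x * αH * (w * te) * ψHe    ≈⟨ *-congʳ (*-congˡ wt≈A⁻¹) ⟩
        x * αH * A′ * ψHe          ∎
        where
        open SetoidReasoning setoid
        open CommutativeSemigroupProperties commutativeSemigroup using (x∙yz≈y∙xz)
        w αH te ψHe A′ : Carrier
        w   = proj₁ ((A ∙ t e) ⁻¹)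
        αH  = proj₁ (α H)
        te  = proj₁ (t e)
        ψHe = proj₁ (ψ H e)
        A′  = proj₁ (A ⁻¹)
        wt≈A⁻¹ : w * te ≈ A′
        wt≈A⁻¹ = begin
          w * te                   ≈⟨ identityʳ _ ⟨
          w * te * 1#              ≈⟨ *-congˡ (inverseʳᵘ A) ⟨
          w * te * (proj₁ A * A′)  ≈⟨ assoc _ _ _ ⟨
          w * te * proj₁ A * A′    ≈⟨ *-congʳ (assoc _ _ _) ⟩
          w * (te * proj₁ A) * A′  ≈⟨ *-congʳ (*-congˡ (comm _ _)) ⟩
          w * (proj₁ A * te) * A′  ≈⟨ *-congʳ (inverseˡᵘ (A ∙ t e)) ⟩
          1# * A′                  ≈⟨ identityˡ _ ⟩
          A′                       ∎
      normalise₁ : ∀ e → proj₁ ((A ∙ t e) ⁻¹) * (proj₁ aᵘ * φ H₁ e) ≈ 1# * proj₁ (ψ H₁ e)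
      normalise₁ e = trans (normalise e aᵘ) (*-congʳ (inverseʳᵘ A))

  reduced : Representation M crossRatioPasture
  reduced = record
    { φ          = ψ
    ; vanishing  = λ H e → mk⇔
        (λ ψ≈0 → Equivalence.to (vanishing H e) (trans (rescaled H e) (trans (*-congˡ ψ≈0) (proj₂ *-zero _))))
        (λ e∈H → *-cancel-0 P (α H ∙ t e) (trans (≈-sym (rescaled H e)) (φ≈0 {H} e∈H)))
    ; three-term = ψ-three-term
    }

  reduced∼ρ : _∼_ M P (pushforward (inclusion P (CrossRatios ρ choice)) reduced) ρ
  reduced∼ρ = record { α = α ; t = t ; rescale = rescaled }

-- Retracting the foundation onto the subpasture by universality.

theorem2p28 : ∀ {ℓ : Level} {n : ℕ} (M : Matroid n) (F : Pasture ℓ)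
    (isFoundation : IsFoundation M F)
    (φ-univ : Representation M F) → IsUniversal isFoundation φ-univ →
    (choice : ∀ θ → Choice M θ) →
    Generates F (CrossRatios φ-univ choice)
theorem2p28 M F isFoundation φ-univ universal choice (u , u≉0) = spanned (⟦ h ⟧ u) (retract u)
  where
  open IsFoundation isFoundation
  open Pasture F
  open CrossRatioSpan M F φ-univ choice
  open PastureHom using (⟦_⟧)

  i : PastureHom crossRatioPasture F
  i = inclusion F (CrossRatios φ-univ choice)

  h : PastureHom F crossRatioPasture
  h = Inverse.from (represents crossRatioPasture) reduced

  classify-i∘h : _∼_ M F (classify (i ∘ʰ h)) (classify idHom)
  classify-i∘h = begin
    classify (i ∘ʰ h)              ≈⟨ natural i h ⟩
    pushforward i (classify h)     ≈⟨ pushforward-∼ i (Inverse.strictlyInverseˡ (represents crossRatioPasture) reduced) ⟩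
    pushforward i reduced          ≈⟨ reduced∼ρ ⟩
    φ-univ                         ≈⟨ universal ⟨
    classify idHom                 ∎
    where open SetoidReasoning (rescalingClasses M F)

  -- Morphisms out of `F` are determined by the rescaling classes which they classify.
  retract : ∀ a → proj₁ (⟦ h ⟧ a) ≈ a
  retract = begin
    i ∘ʰ h                                           ≈⟨ Inverse.strictlyInverseʳ (represents F) (i ∘ʰ h) ⟨
    Inverse.from (represents F) (classify (i ∘ʰ h))  ≈⟨ Inverse.from-cong (represents F) classify-i∘h ⟩
    Inverse.from (represents F) (classify idHom)     ≈⟨ Inverse.strictlyInverseʳ (represents F) idHom ⟩
    idHom                                            ∎
    where open SetoidReasoning (homSetoid F F)

  spanned : (a : Pasture.Carrier crossRatioPasture) → proj₁ a ≈ u →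
            Span unitGroup (λ v → CrossRatios φ-univ choice v ⊎ proj₁ v ≈ proj₁ -1ᵘ) (u , u≉0)
  spanned (a , inj₁ a≈0)        a≈u = contradiction (trans (≈-sym a≈u) a≈0) u≉0
  spanned (a , inj₂ (a≉0 , a∈)) a≈u = resp a≈u a∈
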